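{- $c(4)=4/3$ and $c(8)=332/315$.
   Context: For $n\ge\ell\ge3$, $C(n,\ell)$ is the maximum number of directed cycles of length $\ell$ in an $n$-vertex tournament, $R(n,\ell)=\frac{(\ell-1)!}{2^\ell}\binom n\ell$ is the expected number of such cycles in the uniformly random $n$-vertex tournament, and $c(\ell)=\lim_{n\to\infty}C(n,\ell)/R(n,\ell)$. -}

module Defs where

open import Data.Bool using (Bool; true; false; not; _∧_; if_then_else_)
open import Data.Nat using (ℕ; zero; suc; _≤_; _∸_; _^_; NonZero; _!)
import Data.Nat as ℕ
open import Data.Nat.DivMod using () renaming (_/_ to _div_)
open import Data.Nat.Properties using (m^n≢0)
open import Data.Nat.Combinatorics using (_C_)
open import Data.Fin using (Fin; _≟_)
open import Data.List using (List; []; _∷_; [_]; map; concatMap; allFin; length; filter)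
open import Data.Bool.ListAction using (any)
open import Data.Maybe using (Maybe; just; nothing)
open import Data.Integer using (+_)
open import Data.Rational using (ℚ; _<_; _*_; _-_; ∣_∣; 0ℚ)
import Data.Rational as ℚ
open import Data.Product using (Σ; ∃; _×_)
open import Relation.Nullary using (¬_)
open import Relation.Nullary.Decidable using (⌊_⌋)
open import Relation.Binary.PropositionalEquality using (_≡_)

record Tournament (n : ℕ) : Set where
  field
    arc    : Fin n → Fin n → Bool
    irrefl : ∀ i → arc i i ≡ false
    total  : ∀ i j → ¬ (i ≡ j) → arc i j ≡ not (arc j i)
open Tournament public

allSeqs : (n ℓ : ℕ) → List (List (Fin n))
allSeqs n zero    = [ [] ]
allSeqs n (suc ℓ) = concatMap (λ xs → map (λ x → x ∷ xs) (allFin n)) (allSeqs n ℓ)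

distinct : ∀ {n} → List (Fin n) → Bool
distinct []       = true
distinct (x ∷ xs) = not (any (λ y → ⌊ x ≟ y ⌋) xs) ∧ distinct xs

chain : ∀ {n} → Tournament n → List (Fin n) → Bool
chain T (x ∷ y ∷ xs) = arc T x y ∧ chain T (y ∷ xs)
chain T _            = true

lastArc : ∀ {n} → Tournament n → Fin n → List (Fin n) → Bool
lastArc T x₀ []           = true
lastArc T x₀ (x ∷ [])     = arc T x x₀
lastArc T x₀ (x ∷ y ∷ xs) = lastArc T x₀ (y ∷ xs)

closed : ∀ {n} → Tournament n → List (Fin n) → Bool
closed T []       = true
closed T (x ∷ xs) = chain T (x ∷ xs) ∧ lastArc T x (x ∷ xs)

isCycleSeq : ∀ {n} → Tournament n → List (Fin n) → Bool
isCycleSeq T xs = distinct xs ∧ closed T xs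

cycleSeqs : ∀ {n} → Tournament n → ℕ → ℕ
cycleSeqs {n} T ℓ = length (filter (λ xs → isCycleSeq T xs Data.Bool.≟ true) (allSeqs n ℓ))
  where import Data.Bool

-- number of directed cycles of length ℓ (as subgraphs): each cycle
-- corresponds to exactly ℓ cyclic sequences (its ℓ rotations)
numCycles : ∀ {n} → Tournament n → (ℓ : ℕ) → .{{NonZero ℓ}} → ℕ
numCycles T ℓ = cycleSeqs T ℓ div ℓ

IsMaxCycles : (n ℓ : ℕ) → .{{NonZero ℓ}} → ℕ → Set
IsMaxCycles n ℓ m = (Σ (Tournament n) λ T → numCycles T ℓ ≡ m) × (∀ (T : Tournament n) → numCycles T ℓ ≤ m)

R : ℕ → ℕ → ℚ
R n ℓ = (+ (((ℓ ∸ 1) !) ℕ.* (n C ℓ))) ℚ./ (2 ^ ℓ)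
  where instance _ = m^n≢0 2 ℓ

-- c(ℓ) = c: for the function C(·,ℓ), C(n,ℓ)/R(n,ℓ) → c as n → ∞
-- (stated without division: |C(n,ℓ) - c·R(n,ℓ)| < ε·R(n,ℓ), R(n,ℓ) > 0 for n ≥ ℓ)
LimitIs : (ℓ : ℕ) → .{{NonZero ℓ}} → ℚ → Set
LimitIs ℓ c =
  ∀ (C : ℕ → ℕ) → (∀ n → ℓ ≤ n → IsMaxCycles n ℓ (C n)) →
  ∀ (ε : ℚ) → 0ℚ < ε →
  ∃ λ (N : ℕ) → ∀ n → N ≤ n →
    ∣ (+ (C n)) ℚ./ 1 - c * R n ℓ ∣ < ε * R n ℓ

{-# OPTIONS --safe #-}
module Submission where

-- Let K be the skew ±1 matrix of a tournament on n vertices, J the all-ones matrix and u the all-ones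
-- vector.  Up to O(nˡ⁻¹), 2ˡ times the number of closed ℓ-sequences is tr (J + K)ˡ.  For ℓ = 4 and 8 the
-- terms of the expansion that involve J add up to at most nˡ (a sum of squares), nearly nˡ if Ku is small.
--
-- With k + 1 = ℓ / 2 even, tr Kˡ = Σᵥ |Kᵏ K eᵥ|² is a sum over ℓ-tuples (v, x₁, …, x₂ₖ₊₁), and can be averaged
-- over the orderings of the xᵢ.  Switching so that v dominates leaves a function of a tournament on
-- 2k + 1 vertices, which is maximal for the transitive one: 2 of 6 for ℓ = 4, 272 of 5040 for ℓ = 8.  Hence
-- c(4) = 1 + 2/6 and c(8) = 1 + 272/5040.  The bound 272 is checked on the 2¹⁵ tournaments containing a fixed
-- Hamiltonian path.  Switching the transitive tournament by alternating signs attains every bound asymptotically.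

-- Averaging over orderings is essential: a single ordering contributes a product of signs, for
-- which only the bound 1 is available. The values 2 and 272 are tangent numbers. In a transitive
-- tournament, reverse one of the two arms that leave the midpoint: k signs change, k is odd, and
-- what remains is minus the sum of (-1) to the number of descents over all permutations of 2k + 1
-- points, an Eulerian polynomial at -1.
--
-- The two parts of the expansion ask for different things. The trace of Kˡ is unchanged by
-- conjugation with diagonal signs and so does not see the scores, whereas the terms with J want Ku
-- to be small. The transitive tournament maximises the former but has row sums of order n.
-- Alternating signs keep the trace and make every row sum at most 1 in absolute value. Switching
-- the result at any v gives the linear order cut cyclically at v, again transitive, so the local
-- maximum is attained at every v at once.
--
-- Tuples with a repeated vertex obey only trivial bounds; they number O(nˡ⁻¹), and their cost is
-- carried along as an explicit constant.

open import Defs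
open import Data.Bool as Bool using (Bool; true; false; not; _∧_; _∨_; _xor_; if_then_else_)
open import Data.Bool.ListAction using (any)
open import Data.Bool.Properties using (not-involutive; T-≡)
open import Data.Fin as Fin using (Fin; zero; suc; toℕ)
open import Data.Integer as ℤ using (ℤ; +_; -[1+_]; -_; _+_; _*_; _-_; _≤_; _^_; _≟_; 0ℤ; 1ℤ; +≤+; -≤+; nonNegative; drop‿+≤+)
open import Data.Integer.Properties as ℤₚ using (+-*-semiring)
import Algebra.Properties.Semiring.Sum +-*-semiring as Sum
open import Data.Integer.Solver using (module +-*-Solver)
open import Data.Integer.Tactic.RingSolver using (solve-∀)
open import Data.List using (List; []; _∷_; length; map; _++_; concatMap; allFin; tabulate; filter; replicate)
import Data.List.Properties as Listₚ
open import Data.List.Relation.Binary.Permutation.Propositional using (_↭_; refl; prep; swap; trans; ↭-sym; ↭⇒↭ₛ)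
open import Data.List.Relation.Binary.Permutation.Propositional.Properties using (↭-singleton-inv; ↭-length; shift; All-resp-↭)
import Data.List.Relation.Binary.Permutation.Setoid.Properties as ↭ₛ
open import Data.List.Relation.Unary.All as All using (All; []; _∷_)
import Data.List.Relation.Unary.All.Properties as Allₚ
open import Data.List.Relation.Unary.AllPairs as AllPairs using (AllPairs; []; _∷_)
open import Data.List.Relation.Unary.Linked using (Linked; []; [-]; _∷_)
open import Data.List.Relation.Unary.Linked.Properties using (Linked⇒AllPairs)
open import Data.Nat as ℕ using (ℕ; zero; suc; NonZero; _!; _≤ᵇ_; _<ᵇ_; z≤n; s≤s)
open import Data.Nat.Combinatorics using (_C_; k>n⇒nCk≡0)
open import Data.Nat.Combinatorics.Specification using (nCk≡n!/k![n-k]!; [n∸k]!k!∣n!)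
import Data.Nat.Divisibility as Divisibility
import Data.Nat.DivMod as DivMod
import Data.Nat.Properties as ℕₚ
import Data.Nat.Tactic.RingSolver as ℕ-Ring
open import Data.Product using (_×_; _,_; proj₁; proj₂; ∃; uncurry)
open import Data.Rational as ℚ using (ℚ; mkℚ; 0ℚ; toℚᵘ; _/_)
import Data.Rational.Properties as ℚₚ
open import Data.Rational.Unnormalised as ℚᵘ using (ℚᵘ; mkℚᵘ)
import Data.Rational.Unnormalised.Properties as ℚᵘₚ
open import Data.Sum using (_⊎_; inj₁; inj₂)
open import Function using (_∘_; Equivalence)
open import Relation.Binary using (Symmetric; Transitive)
open import Relation.Binary.PropositionalEquality using (_≡_; _≢_; _≗_; refl; sym; cong; cong₂; subst; subst₂; setoid; resp₂; module ≡-Reasoning) renaming (trans to infixr 4 _⨾_)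
open import Relation.Nullary using (yes; no; contradiction)
open import Relation.Nullary.Decidable using (⌊_⌋; toWitness)

private variable
  A B : Set

-- Sums over vertices and over tuples of vertices

∑-mono-≤ : ∀ {n} {f g : Fin n → ℤ} → (∀ i → f i ≤ g i) → Sum.sum f ≤ Sum.sum g
∑-mono-≤ {zero}  f≤g = ℤₚ.≤-refl
∑-mono-≤ {suc n} f≤g = ℤₚ.+-mono-≤ (f≤g zero) (∑-mono-≤ (f≤g ∘ suc))

∑-constant : ∀ n c → Sum.sum {n} (λ _ → c) ≡ + n * c
∑-constant zero    c = sym (ℤₚ.*-zeroˡ c)
∑-constant (suc n) c = cong (λ x → c + x) (∑-constant n c) ⨾ sym (ℤₚ.suc-* (+ n) c)

module Sums (n : ℕ) where

  ∑ : (Fin n → ℤ) → ℤ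
  ∑ = Sum.sum

  ∑-cong : ∀ {f g} → f ≗ g → ∑ f ≡ ∑ g
  ∑-cong = Sum.sum-cong-≗

  ∑-mono : ∀ {f g} → (∀ i → f i ≤ g i) → ∑ f ≤ ∑ g
  ∑-mono = ∑-mono-≤

  ∑-const : ∀ c → ∑ (λ _ → c) ≡ + n * c
  ∑-const = ∑-constant n

  ∑-+ : ∀ f g → ∑ (λ i → f i + g i) ≡ ∑ f + ∑ g
  ∑-+ = Sum.∑-distrib-+

  ∑-* : ∀ c f → ∑ (λ i → c * f i) ≡ c * ∑ f
  ∑-* c f = sym (Sum.*-distribˡ-sum c f)

  ∑-swap : ∀ (f : Fin n → Fin n → ℤ) → ∑ (λ i → ∑ (f i)) ≡ ∑ (λ j → ∑ λ i → f i j)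
  ∑-swap = Sum.∑-comm

  tuples : ℕ → (List (Fin n) → ℤ) → ℤ
  tuples zero    F = F []
  tuples (suc k) F = ∑ λ x → tuples k (F ∘ (x ∷_))

  tuples-cong : ∀ k {F G} → F ≗ G → tuples k F ≡ tuples k G
  tuples-cong zero    F≗G = F≗G []
  tuples-cong (suc k) F≗G = ∑-cong λ x → tuples-cong k (F≗G ∘ (x ∷_))

  tuples-mono : ∀ k {F G} → (∀ xs → length xs ≡ k → F xs ≤ G xs) → tuples k F ≤ tuples k G
  tuples-mono zero    F≤G = F≤G [] refl
  tuples-mono (suc k) F≤G = ∑-mono λ x → tuples-mono k λ xs |xs|≡k → F≤G (x ∷ xs) (cong suc |xs|≡k)

  tuples-zero : ∀ k {F} → (∀ xs → length xs ≡ k → F xs ≡ 0ℤ) → tuples k F ≡ 0ℤ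
  tuples-zero zero    F≡0 = F≡0 [] refl
  tuples-zero (suc k) F≡0 =
    ∑-cong (λ x → tuples-zero k λ xs |xs|≡k → F≡0 (x ∷ xs) (cong suc |xs|≡k)) ⨾ ∑-const 0ℤ ⨾ ℤₚ.*-zeroʳ (+ n)

  tuples-+ : ∀ k F G → tuples k (λ xs → F xs + G xs) ≡ tuples k F + tuples k G
  tuples-+ zero    F G = refl
  tuples-+ (suc k) F G = ∑-cong (λ x → tuples-+ k (F ∘ (x ∷_)) (G ∘ (x ∷_))) ⨾ ∑-+ _ _

  tuples-* : ∀ k c F → tuples k (λ xs → c * F xs) ≡ c * tuples k F
  tuples-* zero    c F = refl
  tuples-* (suc k) c F = ∑-cong (λ x → tuples-* k c (F ∘ (x ∷_))) ⨾ ∑-* c _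

  tuples-∑ : ∀ k (F : Fin n → List (Fin n) → ℤ) → tuples k (λ xs → ∑ λ i → F i xs) ≡ ∑ λ i → tuples k (F i)
  tuples-∑ zero    F = refl
  tuples-∑ (suc k) F = ∑-cong (λ x → tuples-∑ k λ i → F i ∘ (x ∷_)) ⨾ ∑-swap _

  tuples-const : ∀ k c → tuples k (λ _ → c) ≡ (+ n) ^ k * c
  tuples-const zero    c = sym (ℤₚ.*-identityˡ c)
  tuples-const (suc k) c = ∑-cong (λ _ → tuples-const k c) ⨾ ∑-const _ ⨾ sym (ℤₚ.*-assoc (+ n) ((+ n) ^ k) c)

-- Sums over the ways of dividing a list into two subsequences

splits : ℕ → (List A → List A → ℤ) → List A → ℤ
splits zero    F xs       = F [] xs
splits (suc k) F []       = 0ℤ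
splits (suc k) F (x ∷ xs) = splits k (λ l r → F (x ∷ l) r) xs + splits (suc k) (λ l r → F l (x ∷ r)) xs

splits-cong : ∀ k {F G : List A → List A → ℤ} → (∀ l r → F l r ≡ G l r) → splits k F ≗ splits k G
splits-cong zero    F≗G xs       = F≗G [] xs
splits-cong (suc k) F≗G []       = refl
splits-cong (suc k) F≗G (x ∷ xs) =
  cong₂ _+_ (splits-cong k (λ l → F≗G (x ∷ l)) xs) (splits-cong (suc k) (λ l r → F≗G l (x ∷ r)) xs)

splits-long : ∀ k (F : List A → List A → ℤ) xs → length xs ℕ.< k → splits k F xs ≡ 0ℤ
splits-long (suc k) F []       _         = refl
splits-long (suc k) F (x ∷ xs) (ℕ.s≤s p) =
  cong₂ _+_ (splits-long k _ xs p) (splits-long (suc k) _ xs (ℕₚ.m<n⇒m<1+n p))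

↭-Invariant : (List A → List A → ℤ) → Set
↭-Invariant F = ∀ {l l′ r r′} → l ↭ l′ → r ↭ r′ → F l r ≡ F l′ r′

-- Only a swap of the two leading elements needs work. If both go to the same side, invariance of
-- `F` applies; if they are separated, the two mixed summands change places. With `k = 1` they
-- cannot both go left, hence the extra case.
splits-↭ : ∀ k {F : List A → List A → ℤ} → ↭-Invariant F → ∀ {xs ys} → xs ↭ ys → splits k F xs ≡ splits k F ys
splits-↭ zero    inv p           = inv refl p
splits-↭ (suc k) inv refl        = refl
splits-↭ (suc k) inv (trans p q) = splits-↭ (suc k) inv p ⨾ splits-↭ (suc k) inv q
splits-↭ (suc k) inv (prep x p)  =
  cong₂ _+_ (splits-↭ k (λ l r → inv (prep x l) r) p) (splits-↭ (suc k) (λ l r → inv l (prep x r)) p)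
splits-↭ (suc zero) {F} inv {x ∷ y ∷ xs} {y ∷ x ∷ ys} (swap x y p) = begin
  F (x ∷ []) (y ∷ xs) + (F (y ∷ []) (x ∷ xs) + splits 1 _ xs)
    ≡⟨ cong₂ _+_ (inv refl (prep y p)) (cong₂ _+_ (inv refl (prep x p))
         (splits-↭ 1 (λ l r → inv l (prep x (prep y r))) p ⨾ splits-cong 1 (λ l r → inv refl (swap x y refl)) ys)) ⟩
  F (x ∷ []) (y ∷ ys) + (F (y ∷ []) (x ∷ ys) + splits 1 _ ys)
    ≡⟨ exch (F (x ∷ []) (y ∷ ys)) (F (y ∷ []) (x ∷ ys)) _ ⟩
  F (y ∷ []) (x ∷ ys) + (F (x ∷ []) (y ∷ ys) + splits 1 _ ys) ∎
  where
  open ≡-Reasoning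
  exch : ∀ a b c → a + (b + c) ≡ b + (a + c)
  exch = solve-∀
splits-↭ (suc (suc k)) {F} inv {x ∷ y ∷ xs} {y ∷ x ∷ ys} (swap x y p) = begin
  (splits k _ xs + splits (suc k) _ xs) + (splits (suc k) _ xs + splits (suc (suc k)) _ xs)
    ≡⟨ cong₂ _+_
        (cong₂ _+_ (splits-↭ k (λ l r → inv (prep x (prep y l)) r) p ⨾ splits-cong k (λ l r → inv (swap x y refl) refl) ys)
                   (splits-↭ (suc k) (λ l r → inv (prep x l) (prep y r)) p))
        (cong₂ _+_ (splits-↭ (suc k) (λ l r → inv (prep y l) (prep x r)) p)
                   (splits-↭ (suc (suc k)) (λ l r → inv l (prep x (prep y r))) p
                      ⨾ splits-cong (suc (suc k)) (λ l r → inv refl (swap x y refl)) ys)) ⟩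
  (splits k (λ l r → F (y ∷ x ∷ l) r) ys + splits (suc k) (λ l r → F (x ∷ l) (y ∷ r)) ys)
    + (splits (suc k) (λ l r → F (y ∷ l) (x ∷ r)) ys + splits (suc (suc k)) (λ l r → F l (y ∷ x ∷ r)) ys)
    ≡⟨ exch (splits k _ ys) (splits (suc k) _ ys) (splits (suc k) _ ys) (splits (suc (suc k)) _ ys) ⟩
  (splits k _ ys + splits (suc k) _ ys) + (splits (suc k) _ ys + splits (suc (suc k)) _ ys) ∎
  where
  open ≡-Reasoning
  exch : ∀ a b c d → (a + b) + (c + d) ≡ (a + c) + (b + d)
  exch = solve-∀

-- Pascal's rule in exactly the shape of the recursion of `splits`.
binom : ℕ → ℕ → ℤ
binom n       zero    = 1ℤ
binom zero    (suc k) = 0ℤ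
binom (suc n) (suc k) = binom n k + binom n (suc k)

binom-zero : ∀ k j → k ℕ.< j → binom k j ≡ 0ℤ
binom-zero zero    (suc j) _         = refl
binom-zero (suc k) (suc j) (ℕ.s≤s p) = cong₂ _+_ (binom-zero k j p) (binom-zero k (suc j) (ℕₚ.m<n⇒m<1+n p))

module SplitSums (n : ℕ) where
  open Sums n

  -- The coordinates of a tuple are independent summation variables, so every choice of `k`
  -- positions for the left part contributes the same sum.
  tuples-splits : ∀ m k (F : List (Fin n) → List (Fin n) → ℤ) →
    tuples (k ℕ.+ m) (splits k F) ≡ binom (k ℕ.+ m) k * tuples k (λ l → tuples m (F l))
  tuples-splits m zero    F = sym (ℤₚ.*-identityˡ _)
  tuples-splits m (suc k) F = begin
    ∑ (λ x → tuples (k ℕ.+ m) (λ xs → splits k (λ l r → F (x ∷ l) r) xs + splits (suc k) (λ l r → F l (x ∷ r)) xs))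
      ≡⟨ ∑-cong (λ x → tuples-+ (k ℕ.+ m) _ _ ⨾ cong (_+ tuples (k ℕ.+ m) (splits (suc k) _)) (tuples-splits m k _)) ⨾ ∑-+ _ _ ⟩
    ∑ (λ x → binom (k ℕ.+ m) k * tuples k (λ l → tuples m (F (x ∷ l))))
      + ∑ (λ x → tuples (k ℕ.+ m) (splits (suc k) (λ l r → F l (x ∷ r))))
      ≡⟨ cong₂ _+_ (∑-* (binom (k ℕ.+ m) k) _) (second m) ⟩
    binom (k ℕ.+ m) k * T + binom (k ℕ.+ m) (suc k) * T
      ≡⟨ ℤₚ.*-distribʳ-+ T (binom (k ℕ.+ m) k) _ ⟨
    (binom (k ℕ.+ m) k + binom (k ℕ.+ m) (suc k)) * T ∎
    where
    open ≡-Reasoning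
    T = tuples (suc k) (λ l → tuples m (F l))
    second : ∀ m′ → ∑ (λ x → tuples (k ℕ.+ m′) (splits (suc k) (λ l r → F l (x ∷ r))))
             ≡ binom (k ℕ.+ m′) (suc k) * tuples (suc k) (λ l → tuples m′ (F l))
    -- Only `k` elements remain while the left part still needs `suc k`, so both sides vanish.
    second zero rewrite ℕₚ.+-identityʳ k | binom-zero k (suc k) ℕₚ.≤-refl =
      ∑-cong (λ x → tuples-zero k λ xs e → splits-long (suc k) _ xs (ℕ.s≤s (ℕₚ.≤-reflexive e))) ⨾ ∑-const 0ℤ ⨾ ℤₚ.*-zeroʳ (+ n)
    second (suc m′) rewrite ℕₚ.+-suc k m′ = begin
      ∑ (λ x → tuples (suc k ℕ.+ m′) (splits (suc k) (λ l r → F l (x ∷ r))))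
        ≡⟨ ∑-cong (λ x → tuples-splits m′ (suc k) (λ l r → F l (x ∷ r))) ⨾ ∑-* (binom (suc k ℕ.+ m′) (suc k)) _ ⟩
      binom (suc k ℕ.+ m′) (suc k) * ∑ (λ x → tuples (suc k) (λ l → tuples m′ (λ r → F l (x ∷ r))))
        ≡⟨ cong (binom (suc k ℕ.+ m′) (suc k) *_) (tuples-∑ (suc k) (λ x l → tuples m′ (λ r → F l (x ∷ r)))) ⟨
      binom (suc k ℕ.+ m′) (suc k) * tuples (suc k) (λ l → tuples (suc m′) (F l)) ∎

-- Bounds on absolute values

infix 4 ∣_∣≤_
∣_∣≤_ : ℤ → ℤ → Set
∣ a ∣≤ b = (- b ≤ a) × (a ≤ b)

abs≤⇒0≤ : ∀ {a b} → ∣ a ∣≤ b → 0ℤ ≤ b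
abs≤⇒0≤ {a} {+ _}      _         = +≤+ ℕ.z≤n
abs≤⇒0≤ {+ _}      { -[1+ _ ]} (_ , ())
abs≤⇒0≤ { -[1+ _ ]} { -[1+ _ ]} (() , _)

abs≤-+ : ∀ {a b c d} → ∣ a ∣≤ b → ∣ c ∣≤ d → ∣ a + c ∣≤ b + d
abs≤-+ {b = b} {d = d} (p , q) (p′ , q′) =
  ℤₚ.≤-trans (ℤₚ.≤-reflexive (ℤₚ.neg-distrib-+ b d)) (ℤₚ.+-mono-≤ p p′) , ℤₚ.+-mono-≤ q q′

abs≤-neg : ∀ {a b} → ∣ a ∣≤ b → ∣ - a ∣≤ b
abs≤-neg {a} {b} (p , q) = ℤₚ.neg-mono-≤ q , subst (- a ≤_) (ℤₚ.neg-involutive b) (ℤₚ.neg-mono-≤ p)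

0≤-* : ∀ {a b} → 0ℤ ≤ a → 0ℤ ≤ b → 0ℤ ≤ a * b
0≤-* {+ a} {+ b} _ _ = ℤₚ.≤-trans (+≤+ ℕ.z≤n) (ℤₚ.≤-reflexive (ℤₚ.pos-* a b))

pos-^-nonneg : ∀ m k → 0ℤ ≤ (+ m) ^ k
pos-^-nonneg m zero    = +≤+ ℕ.z≤n
pos-^-nonneg m (suc k) = 0≤-* {+ m} (+≤+ ℕ.z≤n) (pos-^-nonneg m k)

*-mono : ∀ {a b c d} → 0ℤ ≤ a → 0ℤ ≤ d → a ≤ b → c ≤ d → a * c ≤ b * d
*-mono {a} {b} {c} {d} 0≤a 0≤d a≤b c≤d = ℤₚ.≤-trans
  (ℤₚ.*-monoˡ-≤-nonNeg a {{nonNegative 0≤a}} c≤d) (ℤₚ.*-monoʳ-≤-nonNeg d {{nonNegative 0≤d}} a≤b)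

abs≤-* : ∀ {a b c d} → ∣ a ∣≤ b → ∣ c ∣≤ d → ∣ a * c ∣≤ b * d
abs≤-* {+ a} {b} {c} {d} (_ , q) cd@(p′ , q′) =
  ℤₚ.≤-trans (ℤₚ.neg-mono-≤ (*-mono (+≤+ ℕ.z≤n) 0≤d q ℤₚ.≤-refl))
    (subst (_≤ + a * c) (sym (ℤₚ.neg-distribʳ-* (+ a) d)) (ℤₚ.*-monoˡ-≤-nonNeg (+ a) p′))
  , *-mono (+≤+ ℕ.z≤n) 0≤d q q′
  where
  0≤d = abs≤⇒0≤ cd
abs≤-* { -[1+ a ]} {b} {c} {d} ab cd =
  subst (∣_∣≤ b * d) (neg-neg (-[1+ a ]) c) (abs≤-* {+ suc a} {b} { - c} {d} (abs≤-neg ab) (abs≤-neg cd))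
  where
  neg-neg : ∀ x y → - x * - y ≡ x * y
  neg-neg = solve-∀

splits-abs : ∀ k {F G : List A → List A → ℤ} → (∀ l r → ∣ F l r ∣≤ G l r) → ∀ xs → ∣ splits k F xs ∣≤ splits k G xs
splits-abs zero    h xs       = h [] xs
splits-abs (suc k) h []       = ℤₚ.≤-refl , ℤₚ.≤-refl
splits-abs (suc k) h (x ∷ xs) = abs≤-+ (splits-abs k (λ l → h (x ∷ l)) xs) (splits-abs (suc k) (λ l r → h l (x ∷ r)) xs)

-- Symmetrised path weights

-- Under `splits 1` the left part is a single element, so this expresses the choice of one vertex
-- together with the remaining ones.
onSingleton : (A → List A → ℤ) → List A → List A → ℤ
onSingleton f (a ∷ []) r = f a r
onSingleton f _        r = 0ℤ

onSingleton-abs : ∀ {f g : A → List A → ℤ} → (∀ a r → ∣ f a r ∣≤ g a r) → ∀ l r → ∣ onSingleton f l r ∣≤ onSingleton g l r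
onSingleton-abs h []          r = ℤₚ.≤-refl , ℤₚ.≤-refl
onSingleton-abs h (a ∷ [])    r = h a r
onSingleton-abs h (_ ∷ _ ∷ _) r = ℤₚ.≤-refl , ℤₚ.≤-refl

onSingleton-↭ : ∀ {f : A → List A → ℤ} → (∀ a {r r′} → r ↭ r′ → f a r ≡ f a r′) → ↭-Invariant (onSingleton f)
onSingleton-↭ h {[]}        {[]}         p q = refl
onSingleton-↭ h {a ∷ []}    {b ∷ []}     p q with refl ← ↭-singleton-inv p = h a q
onSingleton-↭ h {_ ∷ _ ∷ _} {_ ∷ _ ∷ _}  p q = refl
onSingleton-↭ h {[]}        {_ ∷ _}      p q with () ← ↭-length p
onSingleton-↭ h {_ ∷ _}     {[]}         p q with () ← ↭-length p
onSingleton-↭ h {_ ∷ []}    {_ ∷ _ ∷ _}  p q with () ← ↭-length p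
onSingleton-↭ h {_ ∷ _ ∷ _} {_ ∷ []}     p q with () ← ↭-length p

module Paths {A : Set} (s : A → A → ℤ) (g : A → ℤ) where

  -- The sum of s m a₁ * s a₁ a₂ * ⋯ * s aₖ₋₁ aₖ * g aₖ over the orderings a₁, …, aₖ of the list.
  paths : ℕ → A → List A → ℤ
  paths zero    m _  = g m
  paths (suc k) m xs = splits 1 (onSingleton λ a r → s m a * paths k a r) xs

  -- Pairs of paths of length k from a common start m, jointly using every vertex of a list of 2k + 1 elements.
  doublePaths : ℕ → List A → ℤ
  doublePaths k = splits 1 (onSingleton λ m → splits k λ l r → paths k m l * paths k m r)

  paths-↭ : ∀ k m {xs ys} → xs ↭ ys → paths k m xs ≡ paths k m ys
  paths-↭ zero    m p = refl
  paths-↭ (suc k) m p = splits-↭ 1 (onSingleton-↭ λ a q → cong (s m a *_) (paths-↭ k a q)) p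

  doublePaths-↭ : ∀ k {xs ys} → xs ↭ ys → doublePaths k xs ≡ doublePaths k ys
  doublePaths-↭ k = splits-↭ 1 (onSingleton-↭ λ m → splits-↭ k λ p q → cong₂ _*_ (paths-↭ k m p) (paths-↭ k m q))

open Paths using (paths; doublePaths; doublePaths-↭)

module _ {s : A → A → ℤ} {g : A → ℤ} (∣s∣≤1 : ∀ x y → ∣ s x y ∣≤ 1ℤ) (∣g∣≤1 : ∀ x → ∣ g x ∣≤ 1ℤ) where

  paths-abs : ∀ k m xs → ∣ paths s g k m xs ∣≤ paths (λ _ _ → 1ℤ) (λ _ → 1ℤ) k m xs
  paths-abs zero    m xs = ∣g∣≤1 m
  paths-abs (suc k) m xs = splits-abs 1 (onSingleton-abs λ a r → abs≤-* (∣s∣≤1 m a) (paths-abs k a r)) xs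

  -- The trivial bound, for tuples with repeated vertices, where no tournament argument applies.
  doublePaths-abs : ∀ k xs → ∣ doublePaths s g k xs ∣≤ doublePaths (λ _ _ → 1ℤ) (λ _ → 1ℤ) k xs
  doublePaths-abs k = splits-abs 1 (onSingleton-abs λ m →
    splits-abs k λ l r → abs≤-* (paths-abs k m l) (paths-abs k m r))

factorial : ℕ → ℤ
factorial zero    = 1ℤ
factorial (suc k) = binom (suc k) 1 * factorial k

-- This is (2k + 1)!, factored as the choice of the midpoint, of the vertices of one arm, and of the
-- order within each arm.
orderings : ℕ → ℤ
orderings k = binom (suc (k ℕ.+ k)) 1 * (binom (k ℕ.+ k) k * (factorial k * factorial k))

-- Path sums as powers of a matrix

module Operators (n : ℕ) where
  open Sums n
  open SplitSums n

  apply : (Fin n → Fin n → ℤ) → (Fin n → ℤ) → Fin n → ℤ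
  apply w g x = ∑ λ y → w x y * g y

  power : (Fin n → Fin n → ℤ) → ℕ → (Fin n → ℤ) → Fin n → ℤ
  power w zero    g = g
  power w (suc k) g = apply w (power w k g)

  module _ (s : Fin n → Fin n → ℤ) (g : Fin n → ℤ) where

    -- Summed over all tuples, each of the k! orderings gives the same matrix product.
    tuples-paths : ∀ k m → tuples k (paths s g k m) ≡ factorial k * power s k g m
    tuples-paths zero    m = sym (ℤₚ.*-identityˡ _)
    tuples-paths (suc k) m = begin
      tuples (suc k) (paths s g (suc k) m)
        ≡⟨ tuples-splits k 1 (onSingleton λ a r → s m a * paths s g k a r) ⟩
      binom (suc k) 1 * ∑ (λ a → tuples k (λ r → s m a * paths s g k a r))
        ≡⟨ cong (binom (suc k) 1 *_) (∑-cong (λ a → tuples-* k (s m a) _ ⨾ cong (s m a *_) (tuples-paths k a)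
              ⨾ exch (s m a) (factorial k) (power s k g a)) ⨾ ∑-* (factorial k) _) ⟩
      binom (suc k) 1 * (factorial k * power s (suc k) g m)
        ≡⟨ ℤₚ.*-assoc (binom (suc k) 1) (factorial k) _ ⟨
      factorial (suc k) * power s (suc k) g m ∎
      where
      open ≡-Reasoning
      exch : ∀ a b c → a * (b * c) ≡ b * (a * c)
      exch = solve-∀

    -- Turns a squared norm into a sum over tuples of a function symmetric in the tuple, which can
    -- then be bounded tuple by tuple.
    tuples-doublePaths : ∀ k → tuples (suc (k ℕ.+ k)) (doublePaths s g k)
      ≡ orderings k * ∑ (λ m → power s k g m * power s k g m)
    tuples-doublePaths k = begin
      tuples (suc (k ℕ.+ k)) (doublePaths s g k)
        ≡⟨ tuples-splits (k ℕ.+ k) 1 (onSingleton λ m → splits k λ l r → P m l * P m r) ⟩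
      binom (suc (k ℕ.+ k)) 1 * ∑ (λ m → tuples (k ℕ.+ k) (splits k λ l r → P m l * P m r))
        ≡⟨ cong (binom (suc (k ℕ.+ k)) 1 *_) (∑-cong (λ m → tuples-splits k k (λ l r → P m l * P m r)
             ⨾ cong (b *_) (inner m) ⨾ regroup b (factorial k) (power s k g m)) ⨾ ∑-* (b * (factorial k * factorial k)) _) ⟩
      binom (suc (k ℕ.+ k)) 1 * (b * (factorial k * factorial k) * ∑ (λ m → power s k g m * power s k g m))
        ≡⟨ ℤₚ.*-assoc (binom (suc (k ℕ.+ k)) 1) _ _ ⟨
      _ ∎
      where
      open ≡-Reasoning
      P = paths s g k
      b = binom (k ℕ.+ k) k
      regroup : ∀ b f p → b * ((f * p) * (f * p)) ≡ b * (f * f) * (p * p)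
      regroup = solve-∀
      inner : ∀ m → tuples k (λ l → tuples k (λ r → P m l * P m r)) ≡ (factorial k * power s k g m) * (factorial k * power s k g m)
      inner m = tuples-cong k (λ l → tuples-* k (P m l) (P m) ⨾ ℤₚ.*-comm (P m l) _)
        ⨾ tuples-* k (tuples k (P m)) (P m) ⨾ cong₂ _*_ (tuples-paths k m) (tuples-paths k m)

AllPairs-resp-↭ : ∀ {R : A → A → Set} → Symmetric R → ∀ {xs ys} → xs ↭ ys → AllPairs R xs → AllPairs R ys
AllPairs-resp-↭ {R = R} R-sym p = ↭ₛ.AllPairs-resp-↭ (setoid _) R-sym (resp₂ R) (↭⇒↭ₛ p)

-- The permutation passes hypotheses on the whole list, such as distinctness or skewness, to the two
-- parts.
splits-cong-↭ : ∀ k {F G : List A → List A → ℤ} xs →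
  (∀ l r → length l ≡ k → l ++ r ↭ xs → F l r ≡ G l r) → splits k F xs ≡ splits k G xs
splits-cong-↭ zero    xs       h = h [] xs refl refl
splits-cong-↭ (suc k) []       h = refl
splits-cong-↭ (suc k) (x ∷ xs) h = cong₂ _+_
  (splits-cong-↭ k xs λ l r e p → h (x ∷ l) r (cong suc e) (prep x p))
  (splits-cong-↭ (suc k) xs λ l r e p → h l (x ∷ r) e (trans (shift x l r) (prep x p)))

-- Hamiltonian paths

module Sorting (t : A → A → Bool) where

  -- A condition on a single pair, imposed on lists through `AllPairs`: `t` has to be a tournament
  -- only on the vertices at hand.
  Skew : A → A → Set
  Skew x y = t y x ≡ not (t x y)

  Skew-sym : Symmetric Skew
  Skew-sym {x} {y} e = sym (cong not e ⨾ not-involutive (t x y))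

  _⟶_ : A → A → Set
  x ⟶ y = t x y ≡ true

  insert : A → List A → List A
  insert x []       = x ∷ []
  insert x (y ∷ ys) = if t x y then x ∷ y ∷ ys else y ∷ insert x ys

  insert-↭ : ∀ x ys → insert x ys ↭ x ∷ ys
  insert-↭ x []       = refl
  insert-↭ x (y ∷ ys) with t x y
  ... | true  = refl
  ... | false = trans (prep y (insert-↭ x ys)) (swap y x refl)

  insert-linked : ∀ {x y ys} → All (Skew x) ys → y ⟶ x → Linked _⟶_ (y ∷ ys) → Linked _⟶_ (y ∷ insert x ys)
  insert-linked {ys = []}         _          y⟶x _            = y⟶x ∷ [-]
  insert-linked {x} {ys = z ∷ _} (sk ∷ sks) y⟶x (y⟶z ∷ zs) with t x z in eq
  ... | true  = y⟶x ∷ eq ∷ zs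
  ... | false = y⟶z ∷ insert-linked sks sk zs

  -- Rédei's theorem: insertion sort yields a Hamiltonian path without transitivity. The new vertex
  -- stops before the first vertex it beats, and by skewness the vertex just passed beats it.
  sort : ∀ xs → AllPairs Skew xs → ∃ λ ys → xs ↭ ys × Linked _⟶_ ys
  sort []       _          = [] , refl , []
  sort (x ∷ xs) (sk ∷ sks) with sort xs sks
  ... | ys , p , linked = insert x ys , trans (prep x p) (↭-sym (insert-↭ x ys)) , start ys (All-resp-↭ p sk) linked
    where
    start : ∀ ys → All (Skew x) ys → Linked _⟶_ ys → Linked _⟶_ (insert x ys)
    start []       _          _ = [-]
    start (y ∷ ys) (sk ∷ sks) linked with t x y in eq
    ... | true  = eq ∷ linked
    ... | false = insert-linked sks sk linked

  -- The adjacency matrix above the diagonal, row by row; on a skew list it determines the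
  -- tournament.
  triangle : List A → List (List Bool)
  triangle []       = []
  triangle (x ∷ xs) = map (t x) xs ∷ triangle xs

-- Exhaustive checks

allBits : ℕ → (List Bool → Bool) → Bool
allBits zero    P = P []
allBits (suc k) P = allBits k (λ bs → P (true ∷ bs) ∧ P (false ∷ bs))

∧-true : ∀ {a b} → a ∧ b ≡ true → a ≡ true × b ≡ true
∧-true {true} e = refl , e

allBits-sound : ∀ k {P} → allBits k P ≡ true → ∀ bs → length bs ≡ k → P bs ≡ true
allBits-sound zero    h []           _ = h
allBits-sound (suc k) h (true ∷ bs)  e = proj₁ (∧-true (allBits-sound k h bs (ℕₚ.suc-injective e)))
allBits-sound (suc k) h (false ∷ bs) e = proj₂ (∧-true (allBits-sound k h bs (ℕₚ.suc-injective e)))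

-- The first entry of each nonempty row is an arc of the path and is fixed to `true`. Seven vertices
-- leave 5 + 4 + 3 + 2 + 1 = 15 free bits.
allPathTriangles : ℕ → (List (List Bool) → Bool) → Bool
allPathTriangles zero          P = P []
allPathTriangles (suc zero)    P = P ([] ∷ [])
allPathTriangles (suc (suc k)) P = allPathTriangles (suc k) λ T → allBits k λ r → P ((true ∷ r) ∷ T)

module _ (t : A → A → Bool) where
  open Sorting t

  allPathTriangles-sound : ∀ {P} xs → allPathTriangles (length xs) P ≡ true → Linked _⟶_ xs → P (triangle xs) ≡ true
  allPathTriangles-sound []           h _ = h
  allPathTriangles-sound (x ∷ [])     h _ = h
  allPathTriangles-sound {P} (x ∷ y ∷ xs) h (x⟶y ∷ linked) =
    subst (λ b → P ((b ∷ map (t x) xs) ∷ triangle (y ∷ xs)) ≡ true) (sym x⟶y)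
      (allBits-sound (length xs) (allPathTriangles-sound (y ∷ xs) h linked) (map (t x) xs) (Listₚ.length-map (t x) xs))

-- Seven-vertex tournaments

sign : Bool → ℤ
sign true  = 1ℤ
sign false = - 1ℤ

sign-not : ∀ b → sign (not b) ≡ - sign b
sign-not true  = refl
sign-not false = refl

-- Halved path sums through three vertices are odd and at most 3 in absolute value, so their
-- products can be read from a finite table.
data Value : Set where
  -3′ -1′ 1′ 3′ : Value

value : Value → ℤ
value -3′ = - (+ 3)
value -1′ = - (+ 1)
value 1′  = + 1
value 3′  = + 3

-- Products are shifted by 9 so that the exhaustive check runs on natural numbers.
pair : Value → Value → ℕ
pair -3′ -3′ = 18
pair -3′ -1′ = 12
pair -3′ 1′  = 6
pair -3′ 3′  = 0
pair -1′ -3′ = 12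
pair -1′ -1′ = 10
pair -1′ 1′  = 8
pair -1′ 3′  = 6
pair 1′  -3′ = 6
pair 1′  -1′ = 8
pair 1′  1′  = 10
pair 1′  3′  = 12
pair 3′  -3′ = 0
pair 3′  -1′ = 6
pair 3′  1′  = 12
pair 3′  3′  = 18

pair-value : ∀ a b → value a * value b ≡ + pair a b - + 9
pair-value -3′ -3′ = refl
pair-value -3′ -1′ = refl
pair-value -3′ 1′  = refl
pair-value -3′ 3′  = refl
pair-value -1′ -3′ = refl
pair-value -1′ -1′ = refl
pair-value -1′ 1′  = refl
pair-value -1′ 3′  = refl
pair-value 1′  -3′ = refl
pair-value 1′  -1′ = refl
pair-value 1′  1′  = refl
pair-value 1′  3′  = refl
pair-value 3′  -3′ = refl
pair-value 3′  -1′ = refl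
pair-value 3′  1′  = refl
pair-value 3′  3′  = refl

minus : Bool → Value
minus true  = -1′
minus false = 1′

signSum : Bool → Bool → Bool → Value
signSum true  true  true  = 3′
signSum true  true  false = 1′
signSum true  false true  = 1′
signSum true  false false = -1′
signSum false true  true  = 1′
signSum false true  false = -1′
signSum false false true  = -1′
signSum false false false = -3′

-- Half of the sum of path weights from m through {a, b, c} in all orders: only the middle vertex of a
-- transitive triple contributes, and all three vertices of a cyclic one do.
halfPaths : (ab bc ac ma mb mc : Bool) → Value
halfPaths true  true  true  ma mb mc = minus mb
halfPaths true  true  false ma mb mc = signSum ma mb mc
halfPaths true  false true  ma mb mc = minus mc
halfPaths true  false false ma mb mc = minus ma
halfPaths false true  true  ma mb mc = minus ma
halfPaths false true  false ma mb mc = minus mc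
halfPaths false false true  ma mb mc = signSum ma mb mc
halfPaths false false false ma mb mc = minus mb

-- The first argument holds the arcs from the midpoint to the other six vertices, the second their
-- triangle. The terms are the ten unordered divisions into two arms, so the shift in `pair` adds up
-- to 90.
star : List Bool → List (List Bool) → ℕ
star (s1 ∷ s2 ∷ s3 ∷ s4 ∷ s5 ∷ s6 ∷ [])
     ((a12 ∷ a13 ∷ a14 ∷ a15 ∷ a16 ∷ []) ∷
      (a23 ∷ a24 ∷ a25 ∷ a26 ∷ []) ∷
      (a34 ∷ a35 ∷ a36 ∷ []) ∷
      (a45 ∷ a46 ∷ []) ∷
      (a56 ∷ []) ∷
      [] ∷ []) =
      pair (halfPaths a12 a23 a13 s1 s2 s3) (halfPaths a45 a56 a46 s4 s5 s6)
  ℕ.+ pair (halfPaths a12 a24 a14 s1 s2 s4) (halfPaths a35 a56 a36 s3 s5 s6)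
  ℕ.+ pair (halfPaths a12 a25 a15 s1 s2 s5) (halfPaths a34 a46 a36 s3 s4 s6)
  ℕ.+ pair (halfPaths a12 a26 a16 s1 s2 s6) (halfPaths a34 a45 a35 s3 s4 s5)
  ℕ.+ pair (halfPaths a13 a34 a14 s1 s3 s4) (halfPaths a25 a56 a26 s2 s5 s6)
  ℕ.+ pair (halfPaths a13 a35 a15 s1 s3 s5) (halfPaths a24 a46 a26 s2 s4 s6)
  ℕ.+ pair (halfPaths a13 a36 a16 s1 s3 s6) (halfPaths a24 a45 a25 s2 s4 s5)
  ℕ.+ pair (halfPaths a14 a45 a15 s1 s4 s5) (halfPaths a23 a36 a26 s2 s3 s6)
  ℕ.+ pair (halfPaths a14 a46 a16 s1 s4 s6) (halfPaths a23 a35 a25 s2 s3 s5)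
  ℕ.+ pair (halfPaths a15 a56 a16 s1 s5 s6) (halfPaths a23 a34 a24 s2 s3 s4)
star _ _ = 0

module Triples {A : Set} (t : A → A → Bool) where
  open Sorting t

  signedPaths : A → List A → ℤ
  signedPaths = paths (λ x y → sign (t x y)) (λ _ → 1ℤ) 3

  -- The unfolded form of `signedPaths` on three vertices. With one argument per direction of an
  -- arc, skewness can be substituted arc by arc, after which 2⁶ cases remain.
  paths₃ : (ab ba bc cb ac ca ma mb mc : Bool) → ℤ
  paths₃ ab ba bc cb ac ca ma mb mc =
      sign ma * (sign ab * (sign bc * 1ℤ + 0ℤ) + (sign ac * (sign cb * 1ℤ + 0ℤ) + 0ℤ))
    + (sign mb * (sign ba * (sign ac * 1ℤ + 0ℤ) + (sign bc * (sign ca * 1ℤ + 0ℤ) + 0ℤ))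
    + (sign mc * (sign ca * (sign ab * 1ℤ + 0ℤ) + (sign cb * (sign ba * 1ℤ + 0ℤ) + 0ℤ)) + 0ℤ))

  halfPaths-correct : List Bool → Bool
  halfPaths-correct (ab ∷ bc ∷ ac ∷ ma ∷ mb ∷ mc ∷ []) =
    ⌊ paths₃ ab (not ab) bc (not bc) ac (not ac) ma mb mc ≟ + 2 * value (halfPaths ab bc ac ma mb mc) ⌋
  halfPaths-correct _ = true

  doubled : A → List A → ℤ
  doubled m (a ∷ b ∷ c ∷ []) = + 2 * value (halfPaths (t a b) (t b c) (t a c) (t m a) (t m b) (t m c))
  doubled m _                = 0ℤ

  signedPaths-halfPaths : ∀ m l → length l ≡ 3 → AllPairs Skew l → signedPaths m l ≡ doubled m l
  signedPaths-halfPaths m (a ∷ b ∷ c ∷ []) refl ((ab ∷ ac ∷ []) ∷ (bc ∷ []) ∷ [] ∷ []) = begin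
    paths₃ (t a b) (t b a) (t b c) (t c b) (t a c) (t c a) (t m a) (t m b) (t m c)
      ≡⟨ cong₂ (λ ba cb → paths₃ (t a b) ba (t b c) cb (t a c) (t c a) (t m a) (t m b) (t m c)) ab bc ⟩
    paths₃ (t a b) (not (t a b)) (t b c) (not (t b c)) (t a c) (t c a) (t m a) (t m b) (t m c)
      ≡⟨ cong (λ ca → paths₃ (t a b) (not (t a b)) (t b c) (not (t b c)) (t a c) ca (t m a) (t m b) (t m c)) ac ⟩
    paths₃ (t a b) (not (t a b)) (t b c) (not (t b c)) (t a c) (not (t a c)) (t m a) (t m b) (t m c)
      ≡⟨ toWitness (Equivalence.from T-≡ (allBits-sound 6 {halfPaths-correct} refl (t a b ∷ t b c ∷ t a c ∷ t m a ∷ t m b ∷ t m c ∷ []) refl)) ⟩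
    doubled m (a ∷ b ∷ c ∷ []) ∎
    where open ≡-Reasoning

  -- The left side is what `splits 3` on six elements unfolds to; each unordered division occurs
  -- twice, once for each order of the arms.
  splits-symmetric : ∀ q123 q124 q125 q126 q134 q135 q136 q145 q146 q156 q234 q235 q236 q245 q246 q256 q345 q346 q356 q456 →
    (((q123 * q456 + (q124 * q356 + (q125 * q346 + (q126 * q345 + 0ℤ)))) +
     ((q134 * q256 + (q135 * q246 + (q136 * q245 + 0ℤ))) + ((q145 * q236 + (q146 * q235 + 0ℤ)) + ((q156 * q234 + 0ℤ) + (0ℤ + 0ℤ))))) +
    (((q234 * q156 + (q235 * q146 + (q236 * q145 + 0ℤ))) + ((q245 * q136 + (q246 * q135 + 0ℤ)) + ((q256 * q134 + 0ℤ) + (0ℤ + 0ℤ)))) +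
     (((q345 * q126 + (q346 * q125 + 0ℤ)) + ((q356 * q124 + 0ℤ) + (0ℤ + 0ℤ))) + (((q456 * q123 + 0ℤ) + (0ℤ + 0ℤ)) + ((0ℤ + 0ℤ) + (0ℤ + 0ℤ))))))
    ≡ + 2 * (q123 * q456 + q124 * q356 + q125 * q346 + q126 * q345 + q134 * q256
           + q135 * q246 + q136 * q245 + q145 * q236 + q146 * q235 + q156 * q234)
  splits-symmetric = solve-∀

AllPairs-++⁻ : ∀ {R : A → A → Set} l {r} → AllPairs R (l ++ r) → AllPairs R l × AllPairs R r
AllPairs-++⁻ []      rs       = [] , rs
AllPairs-++⁻ (x ∷ l) (px ∷ p) with AllPairs-++⁻ l p
... | pl , pr = Allₚ.++⁻ˡ l px ∷ pl , pr

nth : ℕ → List Bool → Bool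
nth _       []       = false
nth zero    (b ∷ bs) = b
nth (suc i) (b ∷ bs) = nth i bs

dropNth : ℕ → List Bool → List Bool
dropNth _       []       = []
dropNth zero    (b ∷ bs) = bs
dropNth (suc i) (b ∷ bs) = b ∷ dropNth i bs

-- The row of vertex i in the full adjacency matrix, and the triangle of the other vertices.
delete : ℕ → List (List Bool) → List Bool × List (List Bool)
delete _       []      = [] , []
delete zero    (r ∷ T) = r , T
delete (suc i) (r ∷ T) = let row , T′ = delete i T in not (nth i r) ∷ row , dropNth i r ∷ T′

starAt : List (List Bool) → ℕ → ℕ
starAt T i = uncurry star (delete i T)

stars : List (List Bool) → ℕ
stars T = starAt T 0 ℕ.+ starAt T 1 ℕ.+ starAt T 2 ℕ.+ starAt T 3 ℕ.+ starAt T 4 ℕ.+ starAt T 5 ℕ.+ starAt T 6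

module Seven {A : Set} (t : A → A → Bool) where
  open Sorting t
  open Triples t

  -- The factor 8 combines the two halvings with the two orders of the arms, and 720 = 8 · 90 undoes
  -- the shift.
  star-paths : ∀ m rest → length rest ≡ 6 → AllPairs Skew rest →
    splits 3 (λ l r → signedPaths m l * signedPaths m r) rest ≡ + 8 * + star (map (t m) rest) (triangle rest) - + 720
  star-paths m rest@(a1 ∷ a2 ∷ a3 ∷ a4 ∷ a5 ∷ a6 ∷ []) refl skew = begin
    splits 3 (λ l r → signedPaths m l * signedPaths m r) rest
      ≡⟨ splits-cong-↭ 3 rest (λ l r e p → let sl , sr = AllPairs-++⁻ l (AllPairs-resp-↭ Skew-sym (↭-sym p) skew) in
           cong₂ _*_ (signedPaths-halfPaths m l e sl) (signedPaths-halfPaths m r (length-r l r e p) sr)) ⟩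
    splits 3 (λ l r → doubled m l * doubled m r) rest
      ≡⟨ splits-symmetric
           (d v123) (d v124) (d v125) (d v126) (d v134) (d v135) (d v136) (d v145) (d v146) (d v156)
           (d v234) (d v235) (d v236) (d v245) (d v246) (d v256) (d v345) (d v346) (d v356) (d v456) ⟩
    + 2 * (d v123 * d v456 + d v124 * d v356 + d v125 * d v346 + d v126 * d v345 + d v134 * d v256
           + d v135 * d v246 + d v136 * d v245 + d v145 * d v236 + d v146 * d v235 + d v156 * d v234)
      ≡⟨ cong (+ 2 *_)
            (cong₂ _+_ (cong₂ _+_ (cong₂ _+_ (cong₂ _+_ (cong₂ _+_ (cong₂ _+_ (cong₂ _+_ (cong₂ _+_ (cong₂ _+_ (e v123 v456)
             (e v124 v356))
             (e v125 v346))
             (e v126 v345))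
             (e v134 v256))
             (e v135 v246))
             (e v136 v245))
             (e v145 v236))
             (e v146 v235))
             (e v156 v234)) ⟩
    + 2 * ((+ 4 * p v123 v456 - + 36) + (+ 4 * p v124 v356 - + 36) + (+ 4 * p v125 v346 - + 36)
           + (+ 4 * p v126 v345 - + 36) + (+ 4 * p v134 v256 - + 36)
           + (+ 4 * p v135 v246 - + 36) + (+ 4 * p v136 v245 - + 36)
           + (+ 4 * p v145 v236 - + 36) + (+ 4 * p v146 v235 - + 36) + (+ 4 * p v156 v234 - + 36))
      ≡⟨ collect (p v123 v456) (p v124 v356) (p v125 v346) (p v126 v345)
           (p v134 v256) (p v135 v246) (p v136 v245) (p v145 v236)
           (p v146 v235) (p v156 v234) ⟩
    + 8 * + star (map (t m) rest) (triangle rest) - + 720 ∎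
    where
    open ≡-Reasoning
    length-r : ∀ l r → length l ≡ 3 → l ++ r ↭ rest → length r ≡ 3
    length-r l r e p = ℕₚ.+-cancelˡ-≡ 3 _ _ (cong (ℕ._+ length r) (sym e) ⨾ sym (Listₚ.length-++ l) ⨾ ↭-length p)
    v : A → A → A → Value
    v a b c = halfPaths (t a b) (t b c) (t a c) (t m a) (t m b) (t m c)
    d : Value → ℤ
    d x = + 2 * value x
    p : Value → Value → ℤ
    p x y = + pair x y
    v123 = v a1 a2 a3
    v124 = v a1 a2 a4
    v125 = v a1 a2 a5
    v126 = v a1 a2 a6
    v134 = v a1 a3 a4
    v135 = v a1 a3 a5
    v136 = v a1 a3 a6
    v145 = v a1 a4 a5
    v146 = v a1 a4 a6
    v156 = v a1 a5 a6
    v234 = v a2 a3 a4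
    v235 = v a2 a3 a5
    v236 = v a2 a3 a6
    v245 = v a2 a4 a5
    v246 = v a2 a4 a6
    v256 = v a2 a5 a6
    v345 = v a3 a4 a5
    v346 = v a3 a4 a6
    v356 = v a3 a5 a6
    v456 = v a4 a5 a6
    double : ∀ x y → + 2 * x * (+ 2 * y) ≡ + 4 * (x * y)
    double = solve-∀
    scale : ∀ x → + 4 * (x - + 9) ≡ + 4 * x - + 36
    scale = solve-∀
    e : ∀ x y → d x * d y ≡ + 4 * p x y - + 36
    e x y = double (value x) (value y) ⨾ cong (+ 4 *_) (pair-value x y) ⨾ scale (p x y)
    collect : ∀ p1 p2 p3 p4 p5 p6 p7 p8 p9 p10 →
      + 2 * ((+ 4 * p1 - + 36) + (+ 4 * p2 - + 36) + (+ 4 * p3 - + 36) + (+ 4 * p4 - + 36) + (+ 4 * p5 - + 36)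
           + (+ 4 * p6 - + 36) + (+ 4 * p7 - + 36) + (+ 4 * p8 - + 36) + (+ 4 * p9 - + 36) + (+ 4 * p10 - + 36))
      ≡ + 8 * (p1 + p2 + p3 + p4 + p5 + p6 + p7 + p8 + p9 + p10) - + 720
    collect = solve-∀

  nth-map : ∀ x pre {m post} → nth (length pre) (map (t x) (pre ++ m ∷ post)) ≡ t x m
  nth-map x []        = refl
  nth-map x (_ ∷ pre) = nth-map x pre

  dropNth-map : ∀ x pre {m post} → dropNth (length pre) (map (t x) (pre ++ m ∷ post)) ≡ map (t x) (pre ++ post)
  dropNth-map x []        = refl
  dropNth-map x (y ∷ pre) = cong (t x y ∷_) (dropNth-map x pre)

  -- Rows before `m` record arcs towards `m`; skewness justifies negating them to obtain the row of
  -- `m`.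
  delete-triangle : ∀ pre m post → AllPairs Skew (pre ++ m ∷ post) →
    delete (length pre) (triangle (pre ++ m ∷ post)) ≡ (map (t m) (pre ++ post) , triangle (pre ++ post))
  delete-triangle []        m post skew = refl
  delete-triangle (x ∷ pre) m post (sk ∷ sks) = cong₂ _,_
    (cong₂ _∷_ (cong not (nth-map x pre) ⨾ sym (All.head (Allₚ.++⁻ʳ pre sk))) (cong proj₁ ih))
    (cong₂ _∷_ (dropNth-map x pre) (cong proj₂ ih))
    where ih = delete-triangle pre m post sks

  starAt-triangle : ∀ pre m post → AllPairs Skew (pre ++ m ∷ post) →
    star (map (t m) (pre ++ post)) (triangle (pre ++ post)) ≡ starAt (triangle (pre ++ m ∷ post)) (length pre)
  starAt-triangle pre m post skew = sym (cong (uncurry star) (delete-triangle pre m post skew))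

  -- Seven midpoints give the total shift 7 · 720 = 5040. Thus 664 stars correspond to 8 · 664 -
  -- 5040 = 272.
  doublePaths-stars : ∀ xs → length xs ≡ 7 → AllPairs Skew xs →
    doublePaths (λ x y → sign (t x y)) (λ _ → 1ℤ) 3 xs ≡ + 8 * + stars (triangle xs) - + 5040
  doublePaths-stars xs@(x0 ∷ x1 ∷ x2 ∷ x3 ∷ x4 ∷ x5 ∷ x6 ∷ []) refl skew = begin
    doublePaths (λ x y → sign (t x y)) (λ _ → 1ℤ) 3 xs
      ≡⟨ splits-cong-↭ 1 xs each ⟩
    splits 1 (onSingleton λ m rest → f (star (map (t m) rest) (triangle rest))) xs
      ≡⟨ cong₂ _+_ (at [] x0 (x1 ∷ x2 ∷ x3 ∷ x4 ∷ x5 ∷ x6 ∷ []) {refl})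
           (cong₂ _+_ (at (x0 ∷ []) x1 (x2 ∷ x3 ∷ x4 ∷ x5 ∷ x6 ∷ []) {refl})
           (cong₂ _+_ (at (x0 ∷ x1 ∷ []) x2 (x3 ∷ x4 ∷ x5 ∷ x6 ∷ []) {refl})
           (cong₂ _+_ (at (x0 ∷ x1 ∷ x2 ∷ []) x3 (x4 ∷ x5 ∷ x6 ∷ []) {refl})
           (cong₂ _+_ (at (x0 ∷ x1 ∷ x2 ∷ x3 ∷ []) x4 (x5 ∷ x6 ∷ []) {refl})
           (cong₂ _+_ (at (x0 ∷ x1 ∷ x2 ∷ x3 ∷ x4 ∷ []) x5 (x6 ∷ []) {refl}) (cong (_+ 0ℤ) (at (x0 ∷ x1 ∷ x2 ∷ x3 ∷ x4 ∷ x5 ∷ []) x6 [] {refl}))))))) ⟩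
    f (s 0) + (f (s 1) + (f (s 2) + (f (s 3) + (f (s 4) + (f (s 5) + (f (s 6) + 0ℤ))))))
      ≡⟨ collect (+ s 0) (+ s 1) (+ s 2) (+ s 3) (+ s 4) (+ s 5) (+ s 6) ⟩
    + 8 * + stars (triangle xs) - + 5040 ∎
    where
    open ≡-Reasoning
    f : ℕ → ℤ
    f k = + 8 * + k - + 720
    s = starAt (triangle xs)
    at : ∀ pre m post {same : pre ++ m ∷ post ≡ xs} →
      f (star (map (t m) (pre ++ post)) (triangle (pre ++ post))) ≡ f (starAt (triangle (pre ++ m ∷ post)) (length pre))
    at pre m post {same} = cong f (starAt-triangle pre m post (subst (AllPairs Skew) (sym same) skew))
    each : ∀ l r → length l ≡ 1 → l ++ r ↭ xs → onSingleton (λ m → splits 3 λ l r → signedPaths m l * signedPaths m r) l r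
           ≡ onSingleton (λ m rest → f (star (map (t m) rest) (triangle rest))) l r
    each (m ∷ []) r _ p with AllPairs-resp-↭ Skew-sym (↭-sym p) skew
    ... | _ ∷ sks = star-paths m r (ℕₚ.suc-injective (↭-length p)) sks
    collect : ∀ a b c d e f g → + 8 * a - + 720 + (+ 8 * b - + 720 + (+ 8 * c - + 720 + (+ 8 * d - + 720
      + (+ 8 * e - + 720 + (+ 8 * f - + 720 + (+ 8 * g - + 720 + 0ℤ)))))) ≡ + 8 * (a + b + c + d + e + f + g) - + 5040
    collect = solve-∀

-- The 2¹⁵ tournaments containing the path 0 ⟶ 1 ⟶ ⋯ ⟶ 6; the transitive one attains 664.
stars-≤664 : allPathTriangles 7 (λ T → stars T ≤ᵇ 664) ≡ true
stars-≤664 = refl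

-- Extremal values on three and seven vertices

fullTriangle : ℕ → List (List Bool)
fullTriangle zero    = []
fullTriangle (suc k) = replicate k true ∷ fullTriangle k

module Extremal {A : Set} (t : A → A → Bool) where
  open Sorting t
  open Seven t

  D : ℕ → List A → ℤ
  D = doublePaths (λ x y → sign (t x y)) (λ _ → 1ℤ)

  triangle-full : ∀ {xs} → AllPairs _⟶_ xs → triangle xs ≡ fullTriangle (length xs)
  triangle-full []                       = refl
  triangle-full {x ∷ xs} (x⟶ ∷ p) = cong₂ _∷_ (row x⟶) (triangle-full p)
    where
    row : ∀ {ys} → All (x ⟶_) ys → map (t x) ys ≡ replicate (length ys) true
    row []      = refl
    row (e ∷ es) = cong₂ _∷_ e (row es)

  sorted : ∀ k xs → AllPairs Skew xs → ∃ λ ys → length ys ≡ length xs × AllPairs Skew ys × Linked _⟶_ ys × D k xs ≡ D k ys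
  sorted k xs skew with sort xs skew
  ... | ys , p , linked = ys , sym (↭-length p) , AllPairs-resp-↭ Skew-sym p skew , linked , doublePaths-↭ _ _ k p

  D₁ : (xy yx xz zx yz zy : Bool) → ℤ
  D₁ xy yx xz zx yz zy = f xy xz + (f yx yz + (f zx zy + 0ℤ))
    where
    g : Bool → ℤ
    g b = sign b * 1ℤ + 0ℤ
    f : Bool → Bool → ℤ
    f a b = g a * g b + (g b * g a + 0ℤ)

  D₁-skew : ∀ {x y z} → AllPairs Skew (x ∷ y ∷ z ∷ []) →
    D 1 (x ∷ y ∷ z ∷ []) ≡ D₁ (t x y) (not (t x y)) (t x z) (not (t x z)) (t y z) (not (t y z))
  D₁-skew {x} {y} {z} ((xy ∷ xz ∷ []) ∷ (yz ∷ []) ∷ [] ∷ []) =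
    cong₂ (λ a b → D₁ (t x y) a (t x z) b (t y z) (t z y)) xy xz ⨾ cong (D₁ (t x y) (not (t x y)) (t x z) (not (t x z)) (t y z)) yz

  -- Once the path x ⟶ y ⟶ z is fixed, only the arc between x and z is open: the transitive triple
  -- gives 2, the cyclic one -6.
  D₁-≤ : ∀ xs → length xs ≡ 3 → AllPairs Skew xs → D 1 xs ≤ + 2
  D₁-≤ xs |xs| skew with sorted 1 xs skew
  ... | ys , e , skew′ , linked , eq with ys | e ⨾ |xs|
  ... | x ∷ y ∷ z ∷ [] | refl with linked
  ... | xy ∷ yz ∷ [-] rewrite eq | D₁-skew skew′ | xy | yz with t x z
  ... | true  = ℤₚ.≤-refl
  ... | false = -≤+

  D₃-≤ : ∀ xs → length xs ≡ 7 → AllPairs Skew xs → D 3 xs ≤ + 272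
  D₃-≤ xs |xs| skew with sorted 3 xs skew
  ... | ys , e , skew′ , linked , eq = subst (_≤ + 272) (sym (eq ⨾ doublePaths-stars ys (e ⨾ |xs|) skew′))
    (ℤₚ.+-monoˡ-≤ (- (+ 5040)) (ℤₚ.*-monoˡ-≤-nonNeg (+ 8) (+≤+ stars≤)))
    where
    stars≤ : stars (triangle ys) ℕ.≤ 664
    stars≤ = ℕₚ.≤ᵇ⇒≤ _ 664 (Equivalence.from T-≡ (allPathTriangles-sound t ys
      (subst (λ k → allPathTriangles k (λ T → stars T ≤ᵇ 664) ≡ true) (sym (e ⨾ |xs|)) stars-≤664) linked))

  module _ (⟶-trans : Transitive _⟶_) where

    D₁-transitive : ∀ xs → length xs ≡ 3 → AllPairs Skew xs → D 1 xs ≡ + 2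
    D₁-transitive xs |xs| skew with sorted 1 xs skew
    ... | ys , e , skew′ , linked , eq with ys | e ⨾ |xs| | Linked⇒AllPairs ⟶-trans linked
    ... | x ∷ y ∷ z ∷ [] | refl | (xy ∷ xz ∷ []) ∷ (yz ∷ []) ∷ [] ∷ [] rewrite eq | D₁-skew skew′ | xy | yz | xz = refl

    -- Transitivity turns the Hamiltonian path into a linear order, so every entry of the triangle
    -- is `true` and the value is found by evaluation.
    D₃-transitive : ∀ xs → length xs ≡ 7 → AllPairs Skew xs → D 3 xs ≡ + 272
    D₃-transitive xs |xs| skew with sorted 3 xs skew
    ... | ys , e , skew′ , linked , eq = eq ⨾ doublePaths-stars ys (e ⨾ |xs|) skew′
      ⨾ cong (λ T → + 8 * + stars T - + 5040) (triangle-full (Linked⇒AllPairs ⟶-trans linked) ⨾ cong fullTriangle (e ⨾ |xs|))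

-- Switching

splits-* : ∀ k c (F : List A → List A → ℤ) xs → splits k (λ l r → c * F l r) xs ≡ c * splits k F xs
splits-* zero    c F xs       = refl
splits-* (suc k) c F []       = sym (ℤₚ.*-zeroʳ c)
splits-* (suc k) c F (x ∷ xs) = cong₂ _+_ (splits-* k c _ xs) (splits-* (suc k) c _ xs) ⨾ sym (ℤₚ.*-distribˡ-+ c (splits k _ xs) _)

-- s′ is s conjugated by the diagonal matrix of signs g.
module Switching {A : Set} (s s′ : A → A → ℤ) (g : A → ℤ) where

  Switched : A → A → Set
  Switched x y = s x y * g y ≡ g x * s′ x y × s y x * g x ≡ g y * s′ y x

  Switched-sym : Symmetric Switched
  Switched-sym (p , q) = q , p

  -- The signs telescope along a path: each arc passes its sign from the end to the start, and only
  -- that of `m` survives.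
  paths-switch : ∀ k m xs → AllPairs Switched (m ∷ xs) → paths s g k m xs ≡ g m * paths s′ (λ _ → 1ℤ) k m xs
  paths-switch zero    m xs sw = sym (ℤₚ.*-identityʳ (g m))
  paths-switch (suc k) m xs (sw ∷ sws) = splits-cong-↭ 1 xs each ⨾ splits-* 1 (g m) _ xs
    where
    regroup : ∀ a b c d p → a * b ≡ c * d → a * (b * p) ≡ c * (d * p)
    regroup a b c d p e = sym (ℤₚ.*-assoc a b p) ⨾ cong (_* p) e ⨾ ℤₚ.*-assoc c d p
    each : ∀ l r → length l ≡ 1 → l ++ r ↭ xs → onSingleton (λ a r → s m a * paths s g k a r) l r
           ≡ g m * onSingleton (λ a r → s′ m a * paths s′ (λ _ → 1ℤ) k a r) l r
    each (a ∷ []) r _ p = cong (s m a *_) (paths-switch k a r (AllPairs-resp-↭ Switched-sym (↭-sym p) sws))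
      ⨾ regroup (s m a) (g a) (g m) (s′ m a) (paths s′ (λ _ → 1ℤ) k a r) (proj₁ (All.head (All-resp-↭ (↭-sym p) sw)))

  -- Both arms start at the same midpoint, so the two surviving signs multiply to 1.
  doublePaths-switch : ∀ k xs → AllPairs Switched xs → All (λ x → g x * g x ≡ 1ℤ) xs →
    doublePaths s g k xs ≡ doublePaths s′ (λ _ → 1ℤ) k xs
  doublePaths-switch k xs sw unit = splits-cong-↭ 1 xs each
    where
    square : ∀ x a b → x * x ≡ 1ℤ → (x * a) * (x * b) ≡ a * b
    square x a b e = regroup x a b ⨾ cong (_* (a * b)) e ⨾ ℤₚ.*-identityˡ (a * b)
      where
      regroup : ∀ x a b → (x * a) * (x * b) ≡ (x * x) * (a * b)
      regroup = solve-∀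
    each : ∀ l r → length l ≡ 1 → l ++ r ↭ xs → onSingleton (λ m → splits k λ l r → paths s g k m l * paths s g k m r) l r
           ≡ onSingleton (λ m → splits k λ l r → paths s′ (λ _ → 1ℤ) k m l * paths s′ (λ _ → 1ℤ) k m r) l r
    each (m ∷ []) rest _ p with AllPairs-resp-↭ Switched-sym (↭-sym p) sw
    ... | swm ∷ sws = splits-cong-↭ k rest λ l r _ q →
      let pl , pr = AllPairs-++⁻ l (AllPairs-resp-↭ Switched-sym (↭-sym q) sws)
          ml , mr = Allₚ.++⁻ l (All-resp-↭ (↭-sym q) swm)
      in cong₂ _*_ (paths-switch k m l (ml ∷ pl)) (paths-switch k m r (mr ∷ pr))
         ⨾ square (g m) (paths s′ (λ _ → 1ℤ) k m l) (paths s′ (λ _ → 1ℤ) k m r) (All.head (All-resp-↭ (↭-sym p) unit))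

-- Writing M = J + K with J = u uᵀ, walks a j is the recursion satisfied by uᵀ Mʲ Kᵃ u in terms of
-- the moments m i = uᵀ Kⁱ u, and excess k is tr Mᵏ⁺¹ - tr Kᵏ⁺¹.
module Expansion {X : Set} (_⊕_ _⊗_ : X → X → X) (m : ℕ → X) where

  walks : ℕ → ℕ → X
  walks a zero    = m a
  walks a (suc j) = (m a ⊗ walks 0 j) ⊕ walks (suc a) j

  excessFrom : ℕ → ℕ → X
  excessFrom a zero    = m a
  excessFrom a (suc k) = walks a (suc k) ⊕ excessFrom (suc a) k

  excess : ℕ → X
  excess = excessFrom 0

open Expansion _+_ _*_ using (walks; excessFrom; excess)

walks-cong : ∀ {m m′} → m ≗ m′ → ∀ a j → walks m a j ≡ walks m′ a j
walks-cong e a zero    = e a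
walks-cong e a (suc j) = cong₂ _+_ (cong₂ _*_ (e a) (walks-cong e 0 j)) (walks-cong e (suc a) j)

excessFrom-cong : ∀ {m m′} → m ≗ m′ → ∀ a k → excessFrom m a k ≡ excessFrom m′ a k
excessFrom-cong e a zero    = e a
excessFrom-cong e a (suc k) = cong₂ _+_ (walks-cong e a (suc k)) (excessFrom-cong e (suc a) k)

-- Generic in the carrier, like `Expansion`: the same recursion runs on integers and on the
-- polynomials of the ring solver, which therefore carries out the expansion.
moments : {X : Set} → X → X → X → X → X → (ℕ → X) → ℕ → X
moments o n p q r f 0 = n
moments o n p q r f 1 = o
moments o n p q r f 2 = p
moments o n p q r f 3 = o
moments o n p q r f 4 = q
moments o n p q r f 5 = o
moments o n p q r f 6 = r
moments o n p q r f 7 = o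
moments o n p q r f k = f k

excess₄ : ∀ n p q r f → excess (moments 0ℤ n p q r f) 3 ≡ n * n * n * n + + 4 * n * p
excess₄ n p q r f = solve 4 (λ n p q r → Expansion.excess _:+_ _:*_ (moments (con 0ℤ) n p q r (λ _ → con 0ℤ)) 3
  := n :* n :* n :* n :+ con (+ 4) :* n :* p) refl n p q r
  where open +-*-Solver

excess₈ : ∀ n p q r f → excess (moments 0ℤ n p q r f) 7
  ≡ n ^ 8 + + 8 * n ^ 5 * p + + 8 * n ^ 3 * q + + 12 * n ^ 2 * p * p + + 8 * n * r + + 8 * p * q
excess₈ n p q r f = solve 4 (λ n p q r → Expansion.excess _:+_ _:*_ (moments (con 0ℤ) n p q r (λ _ → con 0ℤ)) 7
  := n :^ 8 :+ con (+ 8) :* n :^ 5 :* p :+ con (+ 8) :* n :^ 3 :* q :+ con (+ 12) :* n :^ 2 :* p :* p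
     :+ con (+ 8) :* n :* r :+ con (+ 8) :* p :* q) refl n p q r
  where open +-*-Solver

-- Traces of powers of a skew matrix `K` and of `J + K`

module Linear (n : ℕ) (w : Fin n → Fin n → ℤ) where
  open Sums n
  open Operators n

  apply-cong : ∀ {f g} → f ≗ g → apply w f ≗ apply w g
  apply-cong e x = ∑-cong λ y → cong (w x y *_) (e y)

  power-cong : ∀ k {f g} → f ≗ g → power w k f ≗ power w k g
  power-cong zero    e = e
  power-cong (suc k) e = apply-cong (power-cong k e)

  power-suc : ∀ k f → power w (suc k) f ≗ power w k (apply w f)
  power-suc zero    f x = refl
  power-suc (suc k) f x = apply-cong (power-suc k f) x

  apply-linear : ∀ c f g x → apply w (λ y → c * f y + g y) x ≡ c * apply w f x + apply w g x
  apply-linear c f g x = ∑-cong (λ y → distrib (w x y) c (f y) (g y)) ⨾ ∑-+ _ _ ⨾ cong (_+ apply w g x) (∑-* c _)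
    where
    distrib : ∀ a c f g → a * (c * f + g) ≡ c * (a * f) + a * g
    distrib = solve-∀

  power-linear : ∀ k c f g x → power w k (λ y → c * f y + g y) x ≡ c * power w k f x + power w k g x
  power-linear zero    c f g x = refl
  power-linear (suc k) c f g x = apply-cong (power-linear k c f g) x ⨾ apply-linear c _ _ x

  power-scale : ∀ k c f x → power w k (λ y → c * f y) x ≡ c * power w k f x
  power-scale zero    c f x = refl
  power-scale (suc k) c f x = apply-cong (power-scale k c f) x ⨾ ∑-cong (λ y → exch (w x y) c (power w k f y)) ⨾ ∑-* c _
    where
    exch : ∀ a b c → a * (b * c) ≡ b * (a * c)
    exch = solve-∀

  power-∑ : ∀ k (c : Fin n → ℤ) (f : Fin n → Fin n → ℤ) x →
    power w k (λ y → ∑ λ z → c z * f z y) x ≡ ∑ λ z → c z * power w k (f z) x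
  power-∑ zero    c f x = refl
  power-∑ (suc k) c f x = begin
    apply w (power w k (λ y → ∑ λ z → c z * f z y)) x
      ≡⟨ apply-cong (power-∑ k c f) x ⟩
    ∑ (λ y → w x y * ∑ (λ z → c z * power w k (f z) y))
      ≡⟨ ∑-cong (λ y → sym (∑-* (w x y) _)) ⨾ ∑-swap (λ y z → w x y * (c z * power w k (f z) y)) ⟩
    ∑ (λ z → ∑ (λ y → w x y * (c z * power w k (f z) y)))
      ≡⟨ ∑-cong (λ z → ∑-cong (λ y → exch (w x y) (c z) (power w k (f z) y)) ⨾ ∑-* (c z) _) ⟩
    ∑ (λ z → c z * power w (suc k) (f z) x) ∎
    where
    open ≡-Reasoning
    exch : ∀ a b c → a * (b * c) ≡ b * (a * c)
    exch = solve-∀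

module SkewMatrix (n : ℕ) (s : Fin n → Fin n → ℤ) (skew : ∀ x y → s y x ≡ - s x y) where
  open Sums n
  open Operators n

  w : Fin n → Fin n → ℤ
  w x y = 1ℤ + s x y

  module K = Linear n s
  module M = Linear n w

  one : Fin n → ℤ
  one _ = 1ℤ

  ⟨_,_⟩ : (Fin n → ℤ) → (Fin n → ℤ) → ℤ
  ⟨ f , g ⟩ = ∑ λ x → f x * g x

  -- The trace of the power `k + 1`: the starting column already supplies one factor.
  trace : (Fin n → Fin n → ℤ) → ℕ → ℤ
  trace v k = ∑ λ z → power v k (λ x → v x z) z

  h : ℕ → Fin n → ℤ
  h k = power s k one

  m : ℕ → ℤ
  m k = ∑ (h k)

  apply-w : ∀ f x → apply w f x ≡ ∑ f + apply s f x
  apply-w f x = ∑-cong (λ y → ℤₚ.*-distribʳ-+ (f y) 1ℤ (s x y) ⨾ cong (_+ s x y * f y) (ℤₚ.*-identityˡ (f y))) ⨾ ∑-+ _ _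

  β : ℕ → ℕ → ℤ
  β a j = ∑ (power w j (h a))

  -- Since `w` is J + K, it sends `h a` to `m a` times the all-ones vector plus `h (suc a)`; the
  -- other `j` factors act linearly.
  β-walks : ∀ a j → β a j ≡ walks m a j
  β-walks a zero    = refl
  β-walks a (suc j) = begin
    ∑ (power w (suc j) (h a))
      ≡⟨ ∑-cong (λ x → M.power-suc j (h a) x
                       ⨾ M.power-cong j (λ y → apply-w (h a) y ⨾ cong (_+ h (suc a) y) (sym (ℤₚ.*-identityʳ (m a)))) x
                       ⨾ M.power-linear j (m a) one (h (suc a)) x) ⟩
    ∑ (λ x → m a * power w j one x + power w j (h (suc a)) x)
      ≡⟨ ∑-+ _ _ ⨾ cong (_+ β (suc a) j) (∑-* (m a) _) ⟩
    m a * β 0 j + β (suc a) j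
      ≡⟨ cong₂ _+_ (cong (m a *_) (β-walks 0 j)) (β-walks (suc a) j) ⟩
    m a * walks m 0 j + walks m (suc a) j ∎
    where open ≡-Reasoning

  -- The difference of `power w k f` and `power s k f`: of the leading factor J + K, the part J
  -- yields a constant vector and the part K is carried on.
  correction : ℕ → (Fin n → ℤ) → Fin n → ℤ
  correction zero    f x = 0ℤ
  correction (suc k) f x = ∑ (power w k f) + apply s (correction k f) x

  power-correction : ∀ k f x → power w k f x ≡ power s k f x + correction k f x
  power-correction zero    f x = sym (ℤₚ.+-identityʳ (f x))
  power-correction (suc k) f x = begin
    apply w (power w k f) x
      ≡⟨ apply-w (power w k f) x ⟩
    S + apply s (power w k f) x
      ≡⟨ cong (λ e → S + e) (K.apply-cong (λ y → power-correction k f y ⨾ cong (_+ correction k f y) (sym (ℤₚ.*-identityˡ (power s k f y)))) x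
                      ⨾ K.apply-linear 1ℤ (power s k f) (correction k f) x
                      ⨾ cong (_+ apply s (correction k f) x) (ℤₚ.*-identityˡ (power s (suc k) f x))) ⟩
    S + (power s (suc k) f x + apply s (correction k f) x)
      ≡⟨ exch S (power s (suc k) f x) (apply s (correction k f) x) ⟩
    power s (suc k) f x + (S + apply s (correction k f) x) ∎
    where
    open ≡-Reasoning
    S = ∑ (power w k f)
    exch : ∀ a b c → a + (b + c) ≡ b + (a + c)
    exch = solve-∀

  col : Fin n → Fin n → ℤ
  col z x = w x z

  -- As J = u uᵀ has rank one, cyclicity of the trace turns Kᵃ J Mᵏ⁺¹ into the scalar uᵀ Mᵏ⁺¹ Kᵃ u,
  -- a value of `walks`. The separate moment comes from the summand 1 in the entries of the starting
  -- column.
  correction-trace : ∀ a k → ∑ (λ z → power s a (correction k (col z)) z) + m (a ℕ.+ k) ≡ excessFrom m a k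
  correction-trace a zero = cong₂ _+_ (∑-cong (λ z → K.power-scale a 0ℤ one z) ⨾ ∑-const 0ℤ ⨾ ℤₚ.*-zeroʳ (+ n))
    (cong m (ℕₚ.+-identityʳ a)) ⨾ ℤₚ.+-identityˡ (m a)
  correction-trace a (suc k) = begin
    ∑ (λ z → power s a (correction (suc k) (col z)) z) + m (a ℕ.+ suc k)
      ≡⟨ cong₂ _+_ (∑-cong (λ z →
             K.power-cong a (λ y → cong (_+ apply s (correction k (col z)) y) (sym (ℤₚ.*-identityʳ (c z)))) z
             ⨾ K.power-linear a (c z) one (apply s (correction k (col z))) z
             ⨾ cong₂ _+_ (ℤₚ.*-comm (c z) (h a z)) (sym (K.power-suc a (correction k (col z)) z))) ⨾ ∑-+ _ _)
           (cong m (ℕₚ.+-suc a k)) ⟩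
    ∑ (λ z → h a z * c z) + ∑ (λ z → power s (suc a) (correction k (col z)) z) + m (suc a ℕ.+ k)
      ≡⟨ ℤₚ.+-assoc (∑ (λ z → h a z * c z)) _ _ ⟩
    ∑ (λ z → h a z * c z) + (∑ (λ z → power s (suc a) (correction k (col z)) z) + m (suc a ℕ.+ k))
      ≡⟨ cong₂ _+_ (first ⨾ β-walks a (suc k)) (correction-trace (suc a) k) ⟩
    walks m a (suc k) + excessFrom m (suc a) k ∎
    where
    open ≡-Reasoning
    c : Fin n → ℤ
    c z = ∑ (power w k (col z))
    first : ∑ (λ z → h a z * c z) ≡ β a (suc k)
    first = ∑-cong (λ z → sym (∑-* (h a z) _)) ⨾ ∑-swap (λ z x → h a z * power w k (col z) x)
      ⨾ ∑-cong (λ x → sym (M.power-∑ k (h a) col x) ⨾ M.power-cong k (λ y → ∑-cong λ z → ℤₚ.*-comm (h a z) (w y z)) x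
                       ⨾ sym (M.power-suc k (h a) x))

  trace-excess : ∀ k → trace w k ≡ trace s k + excess m k
  trace-excess k = begin
    ∑ (λ z → power w k (col z) z)
      ≡⟨ ∑-cong (λ z → power-correction k (col z) z
           ⨾ cong (_+ correction k (col z) z) (K.power-linear k 1ℤ one (λ x → s x z) z ⨾ cong (_+ power s k (λ x → s x z) z) (ℤₚ.*-identityˡ (h k z)))) ⟩
    ∑ (λ z → h k z + power s k (λ x → s x z) z + correction k (col z) z)
      ≡⟨ ∑-+ _ _ ⨾ cong (_+ ∑ (λ z → correction k (col z) z)) (∑-+ _ _) ⟩
    m k + trace s k + ∑ (λ z → correction k (col z) z)
      ≡⟨ exch (m k) (trace s k) _ ⟩
    trace s k + (∑ (λ z → correction k (col z) z) + m k)
      ≡⟨ cong (λ e → trace s k + e) (correction-trace 0 k) ⟩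
    trace s k + excess m k ∎
    where
    open ≡-Reasoning
    exch : ∀ a b c → a + b + c ≡ b + (c + a)
    exch = solve-∀

  adjoint : ∀ f g → ⟨ f , apply s g ⟩ ≡ - ⟨ apply s f , g ⟩
  adjoint f g = begin
    ∑ (λ x → f x * ∑ (λ y → s x y * g y))
      ≡⟨ ∑-cong (λ x → sym (∑-* (f x) _)) ⨾ ∑-swap (λ x y → f x * (s x y * g y)) ⟩
    ∑ (λ y → ∑ (λ x → f x * (s x y * g y)))
      ≡⟨ ∑-cong (λ y → ∑-cong (λ x → cong (λ e → f x * (e * g y)) (skew y x) ⨾ exch (f x) (s y x) (g y)) ⨾ ∑-* (- 1ℤ * g y) _
            ⨾ regroup (g y) (apply s f y)) ⨾ ∑-* (- 1ℤ) _ ⨾ ℤₚ.-1*i≡-i _ ⟩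
    - ∑ (λ y → apply s f y * g y) ∎
    where
    open ≡-Reasoning
    exch : ∀ f s g → f * (- s * g) ≡ (- 1ℤ * g) * (s * f)
    exch = solve-∀
    regroup : ∀ g a → - 1ℤ * g * a ≡ - 1ℤ * (a * g)
    regroup = solve-∀

  ⟨⟩-comm : ∀ f g → ⟨ f , g ⟩ ≡ ⟨ g , f ⟩
  ⟨⟩-comm f g = ∑-cong λ x → ℤₚ.*-comm (f x) (g x)

  transfer : ∀ f a b → ⟨ power s a f , power s (suc b) f ⟩ ≡ - ⟨ power s (suc a) f , power s b f ⟩
  transfer f a b = adjoint (power s a f) (power s b f)

  ⟨one,⟩ : ∀ f → ⟨ one , f ⟩ ≡ ∑ f
  ⟨one,⟩ f = ∑-cong λ x → ℤₚ.*-identityˡ (f x)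

  odd-moment : ∀ a → ⟨ h a , h (suc a) ⟩ ≡ 0ℤ
  odd-moment a = self-neg (transfer one a a ⨾ cong -_ (⟨⟩-comm (h (suc a)) (h a)))
    where
    self-neg : ∀ {x} → x ≡ - x → x ≡ 0ℤ
    self-neg {+ zero}   _ = refl
    self-neg {+ suc _}  ()
    self-neg { -[1+ _ ]} ()

  norm : (Fin n → ℤ) → ℤ
  norm f = ⟨ f , f ⟩

  p q r : ℤ
  p = norm (h 1)
  q = norm (h 2)
  r = norm (h 3)

  -- Moving half of the factors K across the inner product gives (-1)ⁱ |Kⁱu|² for the moment 2i. An
  -- odd moment reduces to some ⟨f, Kf⟩, which is its own negative.
  m-values : m ≗ moments 0ℤ (+ n) (- p) q (- r) m
  m-values 0 = ∑-const 1ℤ ⨾ ℤₚ.*-identityʳ (+ n)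
  m-values 1 = sym (⟨one,⟩ (h 1)) ⨾ odd-moment 0
  m-values 2 = sym (⟨one,⟩ (h 2)) ⨾ transfer one 0 1
  m-values 3 = sym (⟨one,⟩ (h 3)) ⨾ transfer one 0 2 ⨾ cong -_ (odd-moment 1)
  m-values 4 = sym (⟨one,⟩ (h 4)) ⨾ transfer one 0 3 ⨾ cong -_ (transfer one 1 2) ⨾ ℤₚ.neg-involutive q
  m-values 5 = sym (⟨one,⟩ (h 5)) ⨾ transfer one 0 4 ⨾ cong -_ (transfer one 1 3 ⨾ cong -_ (odd-moment 2))
  m-values 6 = sym (⟨one,⟩ (h 6)) ⨾ transfer one 0 5 ⨾ cong -_ (transfer one 1 4 ⨾ cong -_ (transfer one 2 3) ⨾ ℤₚ.neg-involutive r)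
  m-values 7 = sym (⟨one,⟩ (h 7)) ⨾ transfer one 0 6 ⨾ cong -_ (transfer one 1 5 ⨾ cong -_ (transfer one 2 4 ⨾ cong -_ (odd-moment 3)))
  m-values (suc (suc (suc (suc (suc (suc (suc (suc k)))))))) = refl

  square-nonneg : ∀ x → 0ℤ ≤ x * x
  square-nonneg (+ x)      = ℤₚ.≤-trans (+≤+ ℕ.z≤n) (ℤₚ.≤-reflexive (ℤₚ.pos-* x x))
  square-nonneg -[1+ x ]   = +≤+ ℕ.z≤n

  norm-nonneg : ∀ f → 0ℤ ≤ norm f
  norm-nonneg f = ℤₚ.≤-trans (ℤₚ.≤-reflexive (sym (∑-const 0ℤ ⨾ ℤₚ.*-zeroʳ (+ n)))) (∑-mono λ x → square-nonneg (f x))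

  norm-expand : ∀ c d f g → norm (λ x → c * f x + d * g x) ≡ c * c * norm f + + 2 * c * d * ⟨ f , g ⟩ + d * d * norm g
  norm-expand c d f g = ∑-cong (λ x → expand c d (f x) (g x)) ⨾ ∑-+ _ _
    ⨾ cong₂ _+_ (∑-+ _ _ ⨾ cong₂ _+_ (∑-* (c * c) _) (∑-* (+ 2 * c * d) _)) (∑-* (d * d) _)
    where
    expand : ∀ c d x y → (c * x + d * y) * (c * x + d * y) ≡ c * c * (x * x) + + 2 * c * d * (x * y) + d * d * (y * y)
    expand = solve-∀

  row-column : ∀ z g → ∑ (λ y → s z y * g y) ≡ - ⟨ (λ y → s y z) , g ⟩
  row-column z g = ∑-cong (λ y → cong (_* g y) (skew y z) ⨾ sym (ℤₚ.neg-distribˡ-* (s y z) (g y)) ⨾ sym (ℤₚ.-1*i≡-i _))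
    ⨾ ∑-* (- 1ℤ) _ ⨾ ℤₚ.-1*i≡-i _

  -- A row is minus the corresponding column, and each transfer costs a further sign: two signs
  -- here, four for length 8. This is where ℓ / 2 has to be even, so that the squares appear with a
  -- plus sign.
  trace-s₄ : trace s 3 ≡ ∑ (λ v → norm (power s 1 (λ x → s x v)))
  trace-s₄ = ∑-cong λ z → let f = λ x → s x z in
    row-column z (power s 2 f) ⨾ cong -_ (transfer f 0 1) ⨾ ℤₚ.neg-involutive _

  trace-s₈ : trace s 7 ≡ ∑ (λ v → norm (power s 3 (λ x → s x v)))
  trace-s₈ = ∑-cong λ z → let f = λ x → s x z in
    row-column z (power s 6 f)
      ⨾ cong -_ (transfer f 0 5 ⨾ cong -_ (transfer f 1 4 ⨾ cong -_ (transfer f 2 3) ⨾ ℤₚ.neg-involutive _)) ⨾ ℤₚ.neg-involutive _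

  minus-≤ : ∀ {a b} → 0ℤ ≤ b → a - b ≤ a
  minus-≤ {a} {b} 0≤b = ℤₚ.≤-trans (ℤₚ.+-monoʳ-≤ a (ℤₚ.neg-mono-≤ 0≤b)) (ℤₚ.≤-reflexive (ℤₚ.+-identityʳ a))

  N : ℤ
  N = + n

  N-nonneg : 0ℤ ≤ N
  N-nonneg = +≤+ ℕ.z≤n

  trace-w₄ : trace w 3 ≡ trace s 3 + (N ^ 4 - + 4 * N * p)
  trace-w₄ = trace-excess 3 ⨾ cong (λ e → trace s 3 + e)
    (excessFrom-cong m-values 0 3 ⨾ excess₄ N (- p) q (- r) m ⨾ tidy N p)
    where
    tidy : ∀ n p → n * n * n * n + + 4 * n * - p ≡ n ^ 4 - + 4 * n * p
    tidy = solve 2 (λ n p →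
      n :* n :* n :* n :+ con (+ 4) :* n :* :- p := n :^ 4 :- con (+ 4) :* n :* p) refl
      where open +-*-Solver

  -- The loss caused by irregular scores. Its terms have mixed signs, so, unlike the loss `4np` for
  -- length 4, it is not visibly nonnegative.
  deficit₈ : ℤ
  deficit₈ = + 8 * N ^ 5 * p - + 8 * N ^ 3 * q - + 12 * N ^ 2 * p * p + + 8 * N * r + + 8 * p * q

  trace-w₈ : trace w 7 ≡ trace s 7 + (N ^ 8 - deficit₈)
  trace-w₈ = trace-excess 7 ⨾ cong (λ e → trace s 7 + e)
    (excessFrom-cong m-values 0 7 ⨾ excess₈ N (- p) q (- r) m ⨾ tidy N p q r)
    where
    tidy : ∀ n p q r → n ^ 8 + + 8 * n ^ 5 * - p + + 8 * n ^ 3 * q + + 12 * n ^ 2 * - p * - p + + 8 * n * - r + + 8 * - p * q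
      ≡ n ^ 8 - (+ 8 * n ^ 5 * p - + 8 * n ^ 3 * q - + 12 * n ^ 2 * p * p + + 8 * n * r + + 8 * p * q)
    tidy = solve 4 (λ n p q r →
      n :^ 8 :+ con (+ 8) :* n :^ 5 :* :- p :+ con (+ 8) :* n :^ 3 :* q :+ con (+ 12) :* n :^ 2 :* :- p :* :- p
      :+ con (+ 8) :* n :* :- r :+ con (+ 8) :* :- p :* q
      := n :^ 8 :- (con (+ 8) :* n :^ 5 :* p :- con (+ 8) :* n :^ 3 :* q
      :- con (+ 12) :* n :^ 2 :* p :* p :+ con (+ 8) :* n :* r :+ con (+ 8) :* p :* q)) refl
      where open +-*-Solver

  -- Twice the deficit is 4n|2K³u + n²Ku|² + p(|4K²u + 3n²u|² + 3n⁵).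
  deficit₈-nonneg : 0ℤ ≤ deficit₈
  deficit₈-nonneg = ℤₚ.*-cancelˡ-≤-pos 0ℤ deficit₈ (+ 2) (ℤₚ.≤-trans
    (ℤₚ.+-mono-≤ (0≤-* (0≤-* (+≤+ (ℕ.z≤n {4})) N-nonneg) (norm-nonneg f))
                 (0≤-* (norm-nonneg (h 1)) (ℤₚ.+-mono-≤ (norm-nonneg g) (0≤-* (+≤+ (ℕ.z≤n {3})) (pos-^-nonneg n 5)))))
    (ℤₚ.≤-reflexive (cong₂ (λ a b → + 4 * N * a + p * (b + + 3 * N ^ 5)) f-norm g-norm ⨾ combine N p q r)))
    where
    f g : Fin n → ℤ
    f x = + 2 * h 3 x + N * N * h 1 x
    g x = + 4 * h 2 x + + 3 * (N * N) * h 0 x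
    -- The cross terms are ⟨K³u, Ku⟩ = -|K²u|² and ⟨K²u, u⟩ = -|Ku|².
    f-norm : norm f ≡ + 2 * + 2 * r + + 2 * + 2 * (N * N) * - q + N * N * (N * N) * p
    f-norm = norm-expand (+ 2) (N * N) (h 3) (h 1)
      ⨾ cong (λ e → + 2 * + 2 * r + + 2 * + 2 * (N * N) * e + N * N * (N * N) * p) (⟨⟩-comm (h 3) (h 1) ⨾ transfer one 1 2)
    g-norm : norm g ≡ + 4 * + 4 * q + + 2 * + 4 * (+ 3 * (N * N)) * - p + + 3 * (N * N) * (+ 3 * (N * N)) * N
    g-norm = norm-expand (+ 4) (+ 3 * (N * N)) (h 2) (h 0)
      ⨾ cong₂ (λ e e′ → + 4 * + 4 * q + + 2 * + 4 * (+ 3 * (N * N)) * e + + 3 * (N * N) * (+ 3 * (N * N)) * e′)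
              (⟨⟩-comm (h 2) (h 0) ⨾ transfer one 0 1) (m-values 0)
    combine : ∀ n p q r →
      + 4 * n * (+ 2 * + 2 * r + + 2 * + 2 * (n * n) * - q + n * n * (n * n) * p)
        + p * (+ 4 * + 4 * q + + 2 * + 4 * (+ 3 * (n * n)) * - p + + 3 * (n * n) * (+ 3 * (n * n)) * n + + 3 * n ^ 5)
      ≡ + 2 * (+ 8 * n ^ 5 * p - + 8 * n ^ 3 * q - + 12 * n ^ 2 * p * p + + 8 * n * r + + 8 * p * q)
    combine = solve 4 (λ n p q r →
      con (+ 4) :* n :* (con (+ 2) :* con (+ 2) :* r :+ con (+ 2) :* con (+ 2) :* (n :* n) :* :- q :+ n :* n :* (n :* n) :* p)
      :+ p :* (con (+ 4) :* con (+ 4) :* q :+ con (+ 2) :* con (+ 4) :* (con (+ 3) :* (n :* n)) :* :- p :+ con (+ 3) :* (n :* n) :* (con (+ 3) :* (n :* n)) :* n :+ con (+ 3) :* n :^ 5)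
      := con (+ 2) :* (con (+ 8) :* n :^ 5 :* p :- con (+ 8) :* n :^ 3 :* q
      :- con (+ 12) :* n :^ 2 :* p :* p :+ con (+ 8) :* n :* r :+ con (+ 8) :* p :* q)) refl
      where open +-*-Solver

  trace-w₄-≤ : trace w 3 ≤ trace s 3 + N ^ 4
  trace-w₄-≤ = subst (_≤ trace s 3 + N ^ 4) (sym trace-w₄) (ℤₚ.+-monoʳ-≤ (trace s 3)
    (minus-≤ (0≤-* (0≤-* (+≤+ (ℕ.z≤n {4})) N-nonneg) (norm-nonneg (h 1)))))

  trace-w₈-≤ : trace w 7 ≤ trace s 7 + N ^ 8
  trace-w₈-≤ = subst (_≤ trace s 7 + N ^ 8) (sym trace-w₈) (ℤₚ.+-monoʳ-≤ (trace s 7) (minus-≤ deficit₈-nonneg))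

ind : Bool → ℤ
ind b = if b then 1ℤ else 0ℤ

ind-nonneg : ∀ b → 0ℤ ≤ ind b
ind-nonneg true  = +≤+ ℕ.z≤n
ind-nonneg false = +≤+ ℕ.z≤n

ind-∧ : ∀ a b → ind (a ∧ b) ≡ ind a * ind b
ind-∧ true  b = sym (ℤₚ.*-identityˡ (ind b))
ind-∧ false b = sym (ℤₚ.*-zeroˡ (ind b))

-- The count in Defs as a sum over tuples

listSum : (A → ℤ) → List A → ℤ
listSum f []       = 0ℤ
listSum f (x ∷ xs) = f x + listSum f xs

listSum-++ : ∀ (f : A → ℤ) xs ys → listSum f (xs ++ ys) ≡ listSum f xs + listSum f ys
listSum-++ f []       ys = sym (ℤₚ.+-identityˡ _)
listSum-++ f (x ∷ xs) ys = cong (λ e → f x + e) (listSum-++ f xs ys) ⨾ sym (ℤₚ.+-assoc (f x) _ _)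

listSum-concatMap : ∀ (f : B → ℤ) (g : A → List B) xs → listSum f (concatMap g xs) ≡ listSum (λ x → listSum f (g x)) xs
listSum-concatMap f g []       = refl
listSum-concatMap f g (x ∷ xs) = listSum-++ f (g x) (concatMap g xs) ⨾ cong (λ e → listSum f (g x) + e) (listSum-concatMap f g xs)

listSum-cong : ∀ {f g : A → ℤ} → f ≗ g → listSum f ≗ listSum g
listSum-cong e []       = refl
listSum-cong e (x ∷ xs) = cong₂ _+_ (e x) (listSum-cong e xs)

listSum-tabulate : ∀ {n} (f : A → ℤ) (g : Fin n → A) → listSum f (tabulate g) ≡ Sum.sum (f ∘ g)
listSum-tabulate {n = zero}  f g = refl
listSum-tabulate {n = suc n} f g = cong (λ e → f (g zero) + e) (listSum-tabulate f (g ∘ suc))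

listSum-map : ∀ (f : B → ℤ) (g : A → B) xs → listSum f (map g xs) ≡ listSum (f ∘ g) xs
listSum-map f g []       = refl
listSum-map f g (x ∷ xs) = cong (λ e → f (g x) + e) (listSum-map f g xs)

length-filter : ∀ (f : A → Bool) xs → + length (filter (λ x → f x Bool.≟ true) xs) ≡ listSum (ind ∘ f) xs
length-filter f []       = refl
length-filter f (x ∷ xs) with f x
... | true  = cong (λ e → 1ℤ + e) (length-filter f xs)
... | false = length-filter f xs ⨾ sym (ℤₚ.+-identityˡ _)

triangular : ℕ → ℕ
triangular zero    = 0
triangular (suc k) = k ℕ.+ triangular k

module Counting (n : ℕ) where
  open Sums n

  listSum-allSeqs : ∀ ℓ F → listSum F (allSeqs n ℓ) ≡ tuples ℓ F
  listSum-allSeqs zero    F = ℤₚ.+-identityʳ (F [])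
  listSum-allSeqs (suc ℓ) F = listSum-concatMap F _ (allSeqs n ℓ)
    ⨾ listSum-cong (λ xs → listSum-map F (_∷ xs) (allFin n) ⨾ listSum-tabulate (λ x → F (x ∷ xs)) (λ x → x)) (allSeqs n ℓ)
    ⨾ listSum-allSeqs ℓ (λ xs → ∑ λ x → F (x ∷ xs)) ⨾ tuples-∑ ℓ (λ x xs → F (x ∷ xs))

  cycleSeqs-tuples : ∀ T ℓ → + cycleSeqs T ℓ ≡ tuples ℓ (λ xs → ind (isCycleSeq T xs))
  cycleSeqs-tuples T ℓ = length-filter (isCycleSeq T) (allSeqs n ℓ) ⨾ listSum-allSeqs ℓ (ind ∘ isCycleSeq T)

  repeats : List (Fin n) → ℤ
  repeats xs = ind (not (distinct xs))

  ∑-indicator : ∀ {m} (y : Fin m) → Sum.sum (λ x → ind ⌊ x Fin.≟ y ⌋) ≤ 1ℤ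
  ∑-indicator {suc m} zero    = ℤₚ.≤-reflexive (cong (λ e → 1ℤ + e) (∑-constant m 0ℤ ⨾ ℤₚ.*-zeroʳ (+ m)))
  ∑-indicator {suc m} (suc y) = ℤₚ.≤-trans (ℤₚ.≤-reflexive (ℤₚ.+-identityˡ _ ⨾ Sum.sum-cong-≗ down)) (∑-indicator y)
    where
    down : ∀ x → ind ⌊ suc x Fin.≟ suc y ⌋ ≡ ind ⌊ x Fin.≟ y ⌋
    down x with x Fin.≟ y
    ... | yes _ = refl
    ... | no  _ = refl

  ∑-any : ∀ xs → ∑ (λ x → ind (any (λ y → ⌊ x Fin.≟ y ⌋) xs)) ≤ + length xs
  ∑-any []       = ℤₚ.≤-reflexive (∑-const 0ℤ ⨾ ℤₚ.*-zeroʳ (+ n))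
  ∑-any (y ∷ xs) = ℤₚ.≤-trans (∑-mono λ x → union ⌊ x Fin.≟ y ⌋ _)
    (ℤₚ.≤-trans (ℤₚ.≤-reflexive (∑-+ _ _)) (ℤₚ.+-mono-≤ (∑-indicator y) (∑-any xs)))
    where
    union : ∀ a b → ind (a ∨ b) ≤ ind a + ind b
    union true  b = ℤₚ.+-mono-≤ (ℤₚ.≤-refl {1ℤ}) (ind-nonneg b)
    union false b = ℤₚ.≤-reflexive (sym (ℤₚ.+-identityˡ (ind b)))

  -- A union bound: `triangular (suc k)` is the number of pairs of coordinates, and a given pair
  -- coincides in nᵏ tuples.
  tuples-repeats : ∀ k → tuples (suc k) repeats ≤ + triangular (suc k) * (+ n) ^ k
  tuples-repeats zero    = ℤₚ.≤-reflexive (∑-const 0ℤ ⨾ ℤₚ.*-zeroʳ (+ n))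
  tuples-repeats (suc k) = begin
    ∑ (λ x → tuples (suc k) (λ xs → repeats (x ∷ xs)))
      ≤⟨ ∑-mono (λ x → ℤₚ.≤-trans (tuples-mono (suc k) λ xs _ → union (any (λ y → ⌊ x Fin.≟ y ⌋) xs) (distinct xs))
                     (ℤₚ.≤-reflexive (tuples-+ (suc k) (λ xs → ind (any (λ y → ⌊ x Fin.≟ y ⌋) xs)) repeats))) ⟩
    ∑ (λ x → tuples (suc k) (λ xs → ind (any (λ y → ⌊ x Fin.≟ y ⌋) xs)) + tuples (suc k) repeats)
      ≡⟨ ∑-+ _ _ ⨾ cong₂ _+_ (sym (tuples-∑ (suc k) (λ x xs → ind (any (λ y → ⌊ x Fin.≟ y ⌋) xs)))) (∑-const (tuples (suc k) repeats)) ⟩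
    tuples (suc k) (λ xs → ∑ λ x → ind (any (λ y → ⌊ x Fin.≟ y ⌋) xs)) + + n * tuples (suc k) repeats
      ≤⟨ ℤₚ.+-mono-≤ (tuples-mono (suc k) λ xs e → ℤₚ.≤-trans (∑-any xs) (ℤₚ.≤-reflexive (cong +_ e)))
                     (ℤₚ.*-monoˡ-≤-nonNeg (+ n) (tuples-repeats k)) ⟩
    tuples (suc k) (λ _ → + suc k) + + n * (+ triangular (suc k) * (+ n) ^ k)
      ≡⟨ cong (_+ + n * (+ triangular (suc k) * (+ n) ^ k)) (tuples-const (suc k) (+ suc k)) ⟩
    + n * (+ n) ^ k * + suc k + + n * (+ triangular (suc k) * (+ n) ^ k)
      ≡⟨ collect (+ n) ((+ n) ^ k) (+ suc k) (+ triangular (suc k)) ⟩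
    (+ suc k + + triangular (suc k)) * (+ n * (+ n) ^ k) ∎
    where
    open ℤₚ.≤-Reasoning
    union : ∀ a b → ind (not (not a ∧ b)) ≤ ind a + ind (not b)
    union true  b = ℤₚ.+-mono-≤ (ℤₚ.≤-refl {1ℤ}) (ind-nonneg (not b))
    union false b = ℤₚ.≤-reflexive (sym (ℤₚ.+-identityˡ (ind (not b))))
    collect : ∀ n p a b → n * p * a + n * (b * p) ≡ (a + b) * (n * p)
    collect = solve-∀

distinct⇒AllPairs : ∀ {n} (xs : List (Fin n)) → distinct xs ≡ true → AllPairs _≢_ xs
distinct⇒AllPairs []       _ = []
distinct⇒AllPairs (x ∷ xs) d with any (λ y → ⌊ x Fin.≟ y ⌋) xs in eq
... | false = absent xs eq ∷ distinct⇒AllPairs xs d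
  where
  absent : ∀ ys → any (λ y → ⌊ x Fin.≟ y ⌋) ys ≡ false → All (x ≢_) ys
  absent []       _ = []
  absent (y ∷ ys) e with x Fin.≟ y
  ... | no x≢y = x≢y ∷ absent ys e
  ... | yes _ with () ← e

-- Cycle sequences against closed walks weighted by `J + K`

module FromTournament {n : ℕ} (T : Tournament n) where
  open Sums n
  open Operators n
  open Counting n

  -- Skewness forces a zero diagonal. Hence `w` has loops of weight 1, and closed walks using them
  -- are charged to the tuples with repetitions.
  s : Fin n → Fin n → ℤ
  s x y with x Fin.≟ y
  ... | yes _ = 0ℤ
  ... | no  _ = sign (arc T x y)

  s-≢ : ∀ {x y} → x ≢ y → s x y ≡ sign (arc T x y)
  s-≢ {x} {y} x≢y with x Fin.≟ y
  ... | yes x≡y = contradiction x≡y x≢y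
  ... | no  _   = refl

  skew : ∀ x y → s y x ≡ - s x y
  skew x y with x Fin.≟ y | y Fin.≟ x
  ... | yes _   | yes _   = refl
  ... | no x≢y  | no y≢x  = cong sign (total T y x y≢x) ⨾ sign-not (arc T x y)
  ... | yes x≡y | no y≢x  = contradiction (sym x≡y) y≢x
  ... | no x≢y  | yes y≡x = contradiction (sym y≡x) x≢y

  open SkewMatrix n s skew public

  s-abs : ∀ x y → ∣ s x y ∣≤ 1ℤ
  s-abs x y with x Fin.≟ y
  ... | yes _ = -≤+ , +≤+ ℕ.z≤n
  ... | no  _ with arc T x y
  ...   | true  = -≤+ , ℤₚ.≤-refl
  ...   | false = ℤₚ.≤-refl , -≤+

  w-nonneg : ∀ x y → 0ℤ ≤ w x y
  w-nonneg x y = ℤₚ.+-monoʳ-≤ 1ℤ (proj₁ (s-abs x y))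

  w-≤2 : ∀ x y → w x y ≤ + 2
  w-≤2 x y = ℤₚ.+-monoʳ-≤ 1ℤ (proj₂ (s-abs x y))

  w-≢ : ∀ {x y} → x ≢ y → w x y ≡ + 2 * ind (arc T x y)
  w-≢ {x} {y} x≢y rewrite s-≢ x≢y with arc T x y
  ... | true  = refl
  ... | false = refl

  arc-≤w : ∀ x y → + 2 * ind (arc T x y) ≤ w x y
  arc-≤w x y with x Fin.≟ y in eq
  ... | no x≢y with arc T x y
  ...   | true  = ℤₚ.≤-refl
  ...   | false = ℤₚ.≤-refl
  arc-≤w x y | yes refl rewrite irrefl T x = +≤+ ℕ.z≤n

  walk : Fin n → Fin n → List (Fin n) → ℤ
  walk z x []       = w x z
  walk z x (y ∷ ys) = w x y * walk z y ys

  cyclicWalk : List (Fin n) → ℤ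
  cyclicWalk []       = 0ℤ
  cyclicWalk (x ∷ xs) = walk x x xs

  tuples-walk : ∀ k z x → tuples k (walk z x) ≡ power w k (λ y → w y z) x
  tuples-walk zero    z x = refl
  tuples-walk (suc k) z x = ∑-cong λ y → tuples-* k (w x y) _ ⨾ cong (w x y *_) (tuples-walk k z y)

  tuples-cyclicWalk : ∀ k → tuples (suc k) cyclicWalk ≡ trace w k
  tuples-cyclicWalk k = ∑-cong λ x → tuples-walk k x x

  follows : Fin n → Fin n → List (Fin n) → Bool
  follows z x ys = chain T (x ∷ ys) ∧ lastArc T z (x ∷ ys)

  follows-∷ : ∀ z x y ys → ind (follows z x (y ∷ ys)) ≡ ind (arc T x y) * ind (follows z y ys)
  follows-∷ z x y ys = cong ind (assoc (arc T x y) (chain T (y ∷ ys)) (lastArc T z (y ∷ ys))) ⨾ ind-∧ (arc T x y) (follows z y ys)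
    where
    assoc : ∀ a b c → (a ∧ b) ∧ c ≡ a ∧ (b ∧ c)
    assoc true  b c = refl
    assoc false b c = refl

  shuffle : ∀ p a b → (+ 2 * p) * (a * b) ≡ (+ 2 * a) * (p * b)
  shuffle = solve-∀

  walk-nonneg : ∀ z x ys → 0ℤ ≤ walk z x ys
  walk-nonneg z x []       = w-nonneg x z
  walk-nonneg z x (y ∷ ys) = 0≤-* (w-nonneg x y) (walk-nonneg z y ys)

  walk-≤ : ∀ z x ys → walk z x ys ≤ (+ 2) ^ suc (length ys)
  walk-≤ z x []       = w-≤2 x z
  walk-≤ z x (y ∷ ys) = *-mono (w-nonneg x y) (pos-^-nonneg 2 (suc (length ys))) (w-≤2 x y) (walk-≤ z y ys)

  follows-≤ : ∀ z x ys → (+ 2) ^ suc (length ys) * ind (follows z x ys) ≤ walk z x ys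
  follows-≤ z x []       = arc-≤w x z
  follows-≤ z x (y ∷ ys) = subst (_≤ walk z x (y ∷ ys))
    (sym (cong ((+ 2) ^ suc (suc (length ys)) *_) (follows-∷ z x y ys) ⨾ shuffle ((+ 2) ^ suc (length ys)) (ind (arc T x y)) (ind (follows z y ys))))
    (*-mono (0≤-* (+≤+ (ℕ.z≤n {2})) (ind-nonneg (arc T x y))) (walk-nonneg z y ys) (arc-≤w x y) (follows-≤ z y ys))

  follows-≡ : ∀ z x ys → All (_≢ z) (x ∷ ys) → AllPairs _≢_ (x ∷ ys) →
    walk z x ys ≡ (+ 2) ^ suc (length ys) * ind (follows z x ys)
  follows-≡ z x []       (x≢z ∷ []) _ = w-≢ x≢z
  follows-≡ z x (y ∷ ys) (_ ∷ ≢z) ((x≢y ∷ _) ∷ pairs) =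
    cong₂ _*_ (w-≢ x≢y) (follows-≡ z y ys ≢z pairs)
    ⨾ sym (shuffle ((+ 2) ^ suc (length ys)) (ind (arc T x y)) (ind (follows z y ys)))
    ⨾ sym (cong ((+ 2) ^ suc (suc (length ys)) *_) (follows-∷ z x y ys))

  isCycleSeq-≤ : ∀ x xs → (+ 2) ^ suc (length xs) * ind (isCycleSeq T (x ∷ xs)) ≤ cyclicWalk (x ∷ xs)
  isCycleSeq-≤ x xs = ℤₚ.≤-trans (ℤₚ.*-monoˡ-≤-nonNeg ((+ 2) ^ suc (length xs)) {{nonNegative (pos-^-nonneg 2 (suc (length xs)))}}
      (∧-≤ (distinct (x ∷ xs)) (follows x x xs))) (follows-≤ x x xs)
    where
    ∧-≤ : ∀ a b → ind (a ∧ b) ≤ ind b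
    ∧-≤ true  b = ℤₚ.≤-refl
    ∧-≤ false b = ind-nonneg b

  -- Distinct vertices give equality; otherwise the trivial bound 2ˡ is absorbed by `repeats`. A
  -- second vertex is needed: one vertex alone has a loop of weight 1 but neither a cycle nor a
  -- repetition.
  isCycleSeq-≥ : ∀ x y ys → let xs = y ∷ ys in
    cyclicWalk (x ∷ xs) ≤ (+ 2) ^ suc (length xs) * ind (isCycleSeq T (x ∷ xs)) + (+ 2) ^ suc (length xs) * repeats (x ∷ xs)
  isCycleSeq-≥ x y ys with distinct (x ∷ y ∷ ys) in eq
  ... | false = ℤₚ.≤-trans (walk-≤ x x (y ∷ ys)) (ℤₚ.≤-reflexive (zero-one ((+ 2) ^ suc (suc (length ys)))))
    where
    zero-one : ∀ a → a ≡ a * 0ℤ + a * 1ℤ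
    zero-one = solve-∀
  ... | true with distinct⇒AllPairs (x ∷ y ∷ ys) eq
  ...   | (x≢y ∷ x≢) ∷ pairs = ℤₚ.≤-reflexive (exact ⨾ one-zero ((+ 2) ^ suc (suc (length ys))) (ind (follows x x (y ∷ ys))))
    where
    one-zero : ∀ a i → a * i ≡ a * i + a * 0ℤ
    one-zero = solve-∀
    exact : walk x x (y ∷ ys) ≡ (+ 2) ^ suc (suc (length ys)) * ind (follows x x (y ∷ ys))
    exact = cong₂ _*_ (w-≢ x≢y) (follows-≡ x y ys (All.map (_∘ sym) (x≢y ∷ x≢)) pairs)
      ⨾ sym (shuffle ((+ 2) ^ suc (length ys)) (ind (arc T x y)) (ind (follows x y ys)))
      ⨾ sym (cong ((+ 2) ^ suc (suc (length ys)) *_) (follows-∷ x x y ys))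

  cycleSeqs-≤ : ∀ k → (+ 2) ^ suc k * + cycleSeqs T (suc k) ≤ trace w k
  cycleSeqs-≤ k = ℤₚ.≤-trans
    (ℤₚ.≤-reflexive (cong ((+ 2) ^ suc k *_) (cycleSeqs-tuples T (suc k)) ⨾ sym (tuples-* (suc k) ((+ 2) ^ suc k) (ind ∘ isCycleSeq T))))
    (ℤₚ.≤-trans (tuples-mono (suc k) pointwise) (ℤₚ.≤-reflexive (tuples-cyclicWalk k)))
    where
    pointwise : ∀ xs → length xs ≡ suc k → (+ 2) ^ suc k * ind (isCycleSeq T xs) ≤ cyclicWalk xs
    pointwise (x ∷ xs) refl = isCycleSeq-≤ x xs

  trace-w-≤ : ∀ k → trace w (suc k) ≤ (+ 2) ^ suc (suc k) * + cycleSeqs T (suc (suc k))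
    + (+ 2) ^ suc (suc k) * (+ triangular (suc (suc k)) * (+ n) ^ suc k)
  trace-w-≤ k = begin
    trace w (suc k)
      ≡⟨ tuples-cyclicWalk (suc k) ⟨
    tuples ℓ cyclicWalk
      ≤⟨ tuples-mono ℓ pointwise ⟩
    tuples ℓ (λ xs → c * ind (isCycleSeq T xs) + c * repeats xs)
      ≡⟨ tuples-+ ℓ (λ xs → c * ind (isCycleSeq T xs)) (λ xs → c * repeats xs)
           ⨾ cong₂ _+_ (tuples-* ℓ c (ind ∘ isCycleSeq T) ⨾ cong (c *_) (sym (cycleSeqs-tuples T ℓ))) (tuples-* ℓ c repeats) ⟩
    c * + cycleSeqs T ℓ + c * tuples ℓ repeats
      ≤⟨ ℤₚ.+-monoʳ-≤ (c * + cycleSeqs T ℓ) (ℤₚ.*-monoˡ-≤-nonNeg c {{nonNegative (pos-^-nonneg 2 ℓ)}} (tuples-repeats (suc k))) ⟩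
    c * + cycleSeqs T ℓ + c * (+ triangular ℓ * (+ n) ^ suc k) ∎
    where
    open ℤₚ.≤-Reasoning
    ℓ = suc (suc k)
    c = (+ 2) ^ ℓ
    pointwise : ∀ xs → length xs ≡ ℓ → cyclicWalk xs ≤ c * ind (isCycleSeq T xs) + c * repeats xs
    pointwise (x ∷ y ∷ ys) refl = isCycleSeq-≥ x y ys

-- Switching at a vertex and averaging over tuples

agree : Bool → Bool → Bool
agree a b = not (a xor b)

module Local {n : ℕ} (T : Tournament n) where
  open Sums n
  open Operators n
  open Counting n
  open FromTournament T

  column : Fin n → Fin n → ℤ
  column v x = s x v

  -- `agree` multiplies signs, so off `v` and off the diagonal this is `s` conjugated by the signs
  -- in `column v`.
  switched : Fin n → Fin n → Fin n → Bool
  switched v x y = agree (agree (arc T x v) (arc T x y)) (arc T y v)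

  module _ (v : Fin n) where
    open Sorting (switched v)
    open Switching s (λ x y → sign (switched v x y)) (column v)

    switch-eq : ∀ {x y} → x ≢ v → y ≢ v → x ≢ y → s x y * column v y ≡ column v x * sign (switched v x y)
    switch-eq {x} {y} x≢v y≢v x≢y rewrite s-≢ x≢v | s-≢ y≢v | s-≢ x≢y = cases (arc T x v) (arc T x y) (arc T y v)
      where
      cases : ∀ a b c → sign b * sign c ≡ sign a * sign (agree (agree a b) c)
      cases true  true  true  = refl
      cases true  true  false = refl
      cases true  false true  = refl
      cases true  false false = refl
      cases false true  true  = refl
      cases false true  false = refl
      cases false false true  = refl
      cases false false false = refl

    switch-skew : ∀ {x y} → x ≢ y → Skew x y
    switch-skew {x} {y} x≢y = cong (λ b → agree (agree (arc T y v) b) (arc T x v)) (total T y x (x≢y ∘ sym))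
      ⨾ cases (arc T x v) (arc T x y) (arc T y v)
      where
      cases : ∀ a b c → agree (agree c (not b)) a ≡ not (agree (agree a b) c)
      cases true  true  true  = refl
      cases true  true  false = refl
      cases true  false true  = refl
      cases true  false false = refl
      cases false true  true  = refl
      cases false true  false = refl
      cases false false true  = refl
      cases false false false = refl

    column-unit : ∀ {x} → x ≢ v → column v x * column v x ≡ 1ℤ
    column-unit {x} x≢v rewrite s-≢ x≢v with arc T x v
    ... | true  = refl
    ... | false = refl

    doublePaths-switched : ∀ k xs → AllPairs _≢_ (v ∷ xs) →
      doublePaths s (column v) k xs ≡ Extremal.D (switched v) k xs × AllPairs Skew xs
    doublePaths-switched k xs (v≢ ∷ pairs) =
      doublePaths-switch k xs (all-switched xs v≢ pairs) (All.map (λ v≢x → column-unit (v≢x ∘ sym)) v≢) ,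
      AllPairs.map switch-skew pairs
      where
      all-switched : ∀ xs → All (v ≢_) xs → AllPairs _≢_ xs → AllPairs Switched xs
      all-switched []       _          _               = []
      all-switched (x ∷ xs) (v≢x ∷ v≢) (x≢ ∷ pairs) =
        All.map (λ (x≢y , v≢y) → switch-eq (v≢x ∘ sym) (v≢y ∘ sym) x≢y ,
                                  switch-eq (v≢y ∘ sym) (v≢x ∘ sym) (x≢y ∘ sym)) (All.zip (x≢ , v≢))
        ∷ all-switched xs v≢ pairs

  module Estimates (k : ℕ) (B N : ℤ) (0≤B : 0ℤ ≤ B) (0≤N : 0ℤ ≤ N)
    (total : ∀ (xs : List (Fin n)) → length xs ≡ suc (k ℕ.+ k) → doublePaths (λ _ _ → 1ℤ) (λ _ → 1ℤ) k xs ≡ N) where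

    ℓ : ℕ
    ℓ = suc (suc (k ℕ.+ k))

    D : Fin n → List (Fin n) → ℤ
    D v = doublePaths s (column v) k

    squares : ℤ
    squares = ∑ λ v → norm (power s k (column v))

    -- On a tuple with repetitions `D` lies between `- N` and `N`, so exchanging it for `B` costs at
    -- most `N + B` in the estimates; `tuples-repeats` counts such tuples.
    error : ℤ
    error = (N + B) * (+ triangular ℓ * (+ n) ^ suc (k ℕ.+ k))

    D-abs : ∀ v xs → length xs ≡ suc (k ℕ.+ k) → ∣ D v xs ∣≤ N
    D-abs v xs e = subst (∣ D v xs ∣≤_) (total xs e) (doublePaths-abs s-abs (λ x → s-abs x v) k xs)

    ∑-D : ∑ (λ v → tuples (suc (k ℕ.+ k)) (D v)) ≡ orderings k * squares
    ∑-D = ∑-cong (λ v → tuples-doublePaths s (column v) k) ⨾ ∑-* (orderings k) _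

    tuples-bound : ∀ c → tuples ℓ (λ xs → B + c * repeats xs) ≡ (+ n) ^ ℓ * B + c * tuples ℓ repeats
    tuples-bound c = tuples-+ ℓ (λ _ → B) (λ xs → c * repeats xs) ⨾ cong₂ _+_ (tuples-const ℓ B) (tuples-* ℓ c repeats)

    repeats-≤ : (N + B) * tuples ℓ repeats ≤ error
    repeats-≤ = ℤₚ.*-monoˡ-≤-nonNeg (N + B) {{nonNegative (ℤₚ.+-mono-≤ 0≤N 0≤B)}} (tuples-repeats (suc (k ℕ.+ k)))

    module _
      (local : ∀ {t : Fin n → Fin n → Bool} xs → length xs ≡ suc (k ℕ.+ k) → AllPairs (Sorting.Skew t) xs → Extremal.D t k xs ≤ B) where

      D-≤ : ∀ v xs → length xs ≡ suc (k ℕ.+ k) → D v xs ≤ B + (N + B) * repeats (v ∷ xs)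
      D-≤ v xs e with distinct (v ∷ xs) in eq
      ... | false = ℤₚ.≤-trans (proj₂ (D-abs v xs e)) (ℤₚ.≤-trans
                      (ℤₚ.≤-reflexive (sym (ℤₚ.+-identityˡ N)))
                      (ℤₚ.≤-trans (ℤₚ.+-mono-≤ (ℤₚ.+-mono-≤ 0≤B 0≤B) (ℤₚ.≤-refl {N})) (ℤₚ.≤-reflexive (regroup N B))))
        where
        regroup : ∀ n b → b + b + n ≡ b + (n + b) * 1ℤ
        regroup = solve-∀
      ... | true with doublePaths-switched v k xs (distinct⇒AllPairs (v ∷ xs) eq)
      ...   | same , skew-xs = subst₂ _≤_ (sym same) (drop B (N + B)) (local xs e skew-xs)
        where
        drop : ∀ b c → b ≡ b + c * 0ℤ
        drop = solve-∀

      squares-≤ : orderings k * squares ≤ (+ n) ^ ℓ * B + error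
      squares-≤ = begin
        orderings k * squares
          ≡⟨ ∑-D ⟨
        ∑ (λ v → tuples (suc (k ℕ.+ k)) (D v))
          ≤⟨ ∑-mono (λ v → tuples-mono (suc (k ℕ.+ k)) (D-≤ v)) ⟩
        tuples ℓ (λ xs → B + (N + B) * repeats xs)
          ≡⟨ tuples-bound (N + B) ⟩
        (+ n) ^ ℓ * B + (N + B) * tuples ℓ repeats
          ≤⟨ ℤₚ.+-monoʳ-≤ ((+ n) ^ ℓ * B) repeats-≤ ⟩
        (+ n) ^ ℓ * B + error ∎
        where open ℤₚ.≤-Reasoning

    module _
      (local : ∀ v xs → length xs ≡ suc (k ℕ.+ k) → AllPairs (Sorting.Skew (switched v)) xs → Extremal.D (switched v) k xs ≡ B) where

      D-≥ : ∀ v xs → length xs ≡ suc (k ℕ.+ k) → B + - (N + B) * repeats (v ∷ xs) ≤ D v xs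
      D-≥ v xs e with distinct (v ∷ xs) in eq
      ... | false = subst (_≤ D v xs) (regroup N B) (proj₁ (D-abs v xs e))
        where
        regroup : ∀ n b → - n ≡ b + - (n + b) * 1ℤ
        regroup = solve-∀
      ... | true with doublePaths-switched v k xs (distinct⇒AllPairs (v ∷ xs) eq)
      ...   | same , skew-xs = ℤₚ.≤-reflexive (drop B (N + B) ⨾ sym (same ⨾ local v xs e skew-xs))
        where
        drop : ∀ b c → b + - c * 0ℤ ≡ b
        drop = solve-∀

      squares-≥ : (+ n) ^ ℓ * B ≤ orderings k * squares + error
      squares-≥ = begin
        (+ n) ^ ℓ * B
          ≡⟨ cancel ((+ n) ^ ℓ * B) (N + B) (tuples ℓ repeats) ⟩
        (+ n) ^ ℓ * B + - (N + B) * tuples ℓ repeats + (N + B) * tuples ℓ repeats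
          ≤⟨ ℤₚ.+-mono-≤ lower repeats-≤ ⟩
        orderings k * squares + error ∎
        where
        open ℤₚ.≤-Reasoning
        cancel : ∀ a c r → a ≡ a + - c * r + c * r
        cancel = solve-∀
        lower : (+ n) ^ ℓ * B + - (N + B) * tuples ℓ repeats ≤ orderings k * squares
        lower = subst₂ _≤_ (tuples-bound (- (N + B))) ∑-D (∑-mono λ v → tuples-mono (suc (k ℕ.+ k)) (D-≥ v))

-- The alternating tournament

even : ∀ {n} → Fin n → Bool
even zero    = true
even (suc i) = not (even i)

-- For i < j there is an arc from i to j exactly when i and j have the same parity: the transitive
-- tournament switched by the alternating signs, so its row sums are bounded.
alternating : ∀ {n} → Fin n → Fin n → Bool
alternating zero    zero    = false
alternating zero    (suc j) = not (even j)
alternating (suc i) zero    = even i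
alternating (suc i) (suc j) = alternating i j

alternatingTournament : ∀ n → Tournament n
alternatingTournament n = record { arc = alternating ; irrefl = irr ; total = tot }
  where
  irr : ∀ {n} (i : Fin n) → alternating i i ≡ false
  irr zero    = refl
  irr (suc i) = irr i
  tot : ∀ {n} (i j : Fin n) → i ≢ j → alternating i j ≡ not (alternating j i)
  tot zero    zero    i≢j = contradiction refl i≢j
  tot zero    (suc j) _   = refl
  tot (suc i) zero    _   = sym (not-involutive (even i))
  tot (suc i) (suc j) i≢j = tot i j (i≢j ∘ cong suc)

-- The cyclic order starting at v

rotated : (v x y : ℕ) → Bool
rotated v x y = agree (agree (x <ᵇ v) (x <ᵇ y)) (y <ᵇ v)

-- The linear order v, v + 1, ... followed by 0, ..., v - 1, with one constructor for each
-- admissible pair of blocks. Transitivity, hidden in the Boolean formula, becomes a case analysis.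
data Rotated (v x y : ℕ) : Set where
  below : x ℕ.< y → y ℕ.< v → Rotated v x y
  above : v ℕ.≤ x → x ℕ.< y → Rotated v x y
  wrap  : y ℕ.< v → v ℕ.≤ x → Rotated v x y

Rotated-trans : ∀ {v} → Transitive (Rotated v)
Rotated-trans (below p _)   (below q q′)  = below (ℕₚ.<-trans p q) q′
Rotated-trans (below _ p)   (above q _)   = contradiction q (ℕₚ.<⇒≱ p)
Rotated-trans (below _ p)   (wrap _ q)    = contradiction q (ℕₚ.<⇒≱ p)
Rotated-trans (above p p′)  (below q q′)  = contradiction (ℕₚ.≤-trans p (ℕₚ.<⇒≤ p′)) (ℕₚ.<⇒≱ (ℕₚ.<-trans q q′))
Rotated-trans (above p p′)  (above _ q)   = above p (ℕₚ.<-trans p′ q)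
Rotated-trans (above p _)   (wrap q _)    = wrap q p
Rotated-trans (wrap _ p)    (below q q′)  = wrap q′ p
Rotated-trans (wrap p _)    (above q _)   = contradiction q (ℕₚ.<⇒≱ p)
Rotated-trans (wrap p _)    (wrap _ q)    = contradiction q (ℕₚ.<⇒≱ p)

<⇒true : ∀ {a b} → a ℕ.< b → (a <ᵇ b) ≡ true
<⇒true = Equivalence.to T-≡ ∘ ℕₚ.<⇒<ᵇ

≥⇒false : ∀ {a b} → b ℕ.≤ a → (a <ᵇ b) ≡ false
≥⇒false {a} {b} b≤a with a <ᵇ b in eq
... | false = refl
... | true  = contradiction b≤a (ℕₚ.<⇒≱ (ℕₚ.<ᵇ⇒< a b (Equivalence.from T-≡ eq)))

rotated-complete : ∀ {v x y} → Rotated v x y → rotated v x y ≡ true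
rotated-complete (below x<y y<v) rewrite <⇒true x<y | <⇒true y<v | <⇒true (ℕₚ.<-trans x<y y<v) = refl
rotated-complete (above v≤x x<y) rewrite <⇒true x<y | ≥⇒false v≤x | ≥⇒false (ℕₚ.≤-trans v≤x (ℕₚ.<⇒≤ x<y)) = refl
rotated-complete (wrap y<v v≤x)  rewrite <⇒true y<v | ≥⇒false v≤x | ≥⇒false (ℕₚ.≤-trans (ℕₚ.<⇒≤ y<v) v≤x) = refl

rotated-sound : ∀ v x y → rotated v x y ≡ true → Rotated v x y
rotated-sound v x y e with ℕₚ.<-≤-connex x v | ℕₚ.<-≤-connex y v | ℕₚ.<-≤-connex x y
... | inj₁ x<v | inj₁ y<v | inj₁ x<y = below x<y y<v
... | inj₂ v≤x | inj₂ v≤y | inj₁ x<y = above v≤x x<y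
... | inj₂ v≤x | inj₁ y<v | _        = wrap y<v v≤x
... | inj₁ x<v | inj₂ v≤y | inj₂ y≤x = contradiction (ℕₚ.≤-trans v≤y y≤x) (ℕₚ.<⇒≱ x<v)
rotated-sound v x y e | inj₁ x<v | inj₁ y<v | inj₂ y≤x rewrite <⇒true x<v | <⇒true y<v | ≥⇒false y≤x with () ← e
rotated-sound v x y e | inj₂ v≤x | inj₂ v≤y | inj₂ y≤x rewrite ≥⇒false v≤x | ≥⇒false v≤y | ≥⇒false y≤x with () ← e
rotated-sound v x y e | inj₁ x<v | inj₂ v≤y | inj₁ x<y rewrite <⇒true x<v | ≥⇒false v≤y | <⇒true x<y with () ← e

alternating-agree : ∀ {n} (i j : Fin n) → alternating i j ≡ agree (toℕ i <ᵇ toℕ j) (agree (even i) (even j))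
alternating-agree zero    zero    = refl
alternating-agree zero    (suc j) with even j
... | true  = refl
... | false = refl
alternating-agree (suc i) zero    with even i
... | true  = refl
... | false = refl
alternating-agree (suc i) (suc j) = alternating-agree i j ⨾ cong (agree (toℕ i <ᵇ toℕ j)) (both (even i) (even j))
  where
  both : ∀ a b → agree a b ≡ agree (not a) (not b)
  both true  true  = refl
  both true  false = refl
  both false true  = refl
  both false false = refl

module Alternating (n : ℕ) where
  open Local (alternatingTournament n) using (switched)

  -- The parity of each of v, x and y enters exactly two of the three arcs and cancels, leaving only
  -- comparisons.
  switched-rotated : ∀ v x y → switched v x y ≡ rotated (toℕ v) (toℕ x) (toℕ y)
  switched-rotated v x y rewrite alternating-agree x v | alternating-agree x y | alternating-agree y v =
    toWitness (Equivalence.from T-≡ (allBits-sound 6 {cancel} refl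
      ((toℕ x <ᵇ toℕ v) ∷ (toℕ x <ᵇ toℕ y) ∷ (toℕ y <ᵇ toℕ v) ∷ even v ∷ even x ∷ even y ∷ []) refl))
    where
    cancel : List Bool → Bool
    cancel (a ∷ b ∷ c ∷ v ∷ x ∷ y ∷ []) =
      ⌊ agree (agree (agree a (agree x v)) (agree b (agree x y))) (agree c (agree y v)) Bool.≟ agree (agree a b) c ⌋
    cancel _ = true

  switched-transitive : ∀ v → Transitive (Sorting._⟶_ (switched v))
  switched-transitive v {x} {y} {z} p q = switched-rotated v x z ⨾ rotated-complete {toℕ v} {toℕ x} {toℕ z} (Rotated-trans
    (rotated-sound (toℕ v) (toℕ x) (toℕ y) (sym (switched-rotated v x y) ⨾ p))
    (rotated-sound (toℕ v) (toℕ y) (toℕ z) (sym (switched-rotated v y z) ⨾ q)))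

-- Row sums of the alternating tournament

entry : ∀ {n} → Fin n → Fin n → ℤ
entry zero    zero    = 0ℤ
entry zero    (suc j) = - sign (even j)
entry (suc i) zero    = sign (even i)
entry (suc i) (suc j) = entry i j

∑-neg : ∀ {n} (f : Fin n → ℤ) → Sum.sum (λ i → - f i) ≡ - Sum.sum f
∑-neg f = Sum.sum-cong-≗ (λ i → sym (ℤₚ.-1*i≡-i (f i))) ⨾ sym (Sum.*-distribˡ-sum (- 1ℤ) f) ⨾ ℤₚ.-1*i≡-i _

∑-sign : ∀ n → let S = Sum.sum (λ (j : Fin n) → sign (even j)) in S ≡ 0ℤ ⊎ S ≡ 1ℤ
∑-sign zero    = inj₁ refl
∑-sign (suc n) with ∑-sign n | Sum.sum-cong-≗ {n} (λ j → sign-not (even j)) ⨾ ∑-neg (λ (j : Fin n) → sign (even j))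
... | inj₁ e | neg = inj₂ (cong (λ x → 1ℤ + x) (neg ⨾ cong -_ e))
... | inj₂ e | neg = inj₁ (cong (λ x → 1ℤ + x) (neg ⨾ cong -_ e))

rowSum : ∀ {n} → Fin n → ℤ
rowSum i = Sum.sum (entry i)

-- The bound 1 on absolute values is not inductive: prepending a vertex flips the parity and adds a
-- sign. Remembering the parity closes the induction.
data RowSum : Bool → ℤ → Set where
  even-zero : RowSum true 0ℤ
  even-neg  : RowSum true (- 1ℤ)
  odd-zero  : RowSum false 0ℤ
  odd-one   : RowSum false 1ℤ

rowSum-small : ∀ {n} (i : Fin n) → RowSum (even i) (rowSum i)
rowSum-small {suc n} zero with ∑-sign n | ∑-neg (λ (j : Fin n) → sign (even j))
... | inj₁ e | neg = subst (RowSum true) (sym (ℤₚ.+-identityˡ _ ⨾ neg ⨾ cong -_ e)) even-zero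
... | inj₂ e | neg = subst (RowSum true) (sym (ℤₚ.+-identityˡ _ ⨾ neg ⨾ cong -_ e)) even-neg
rowSum-small (suc i) = step (rowSum-small i)
  where
  step : ∀ {b r} → RowSum b r → RowSum (not b) (sign b + r)
  step even-zero = odd-one
  step even-neg  = odd-zero
  step odd-zero  = even-neg
  step odd-one   = even-zero

rowSum-abs : ∀ {n} (i : Fin n) → ∣ rowSum i ∣≤ 1ℤ
rowSum-abs i = bound (rowSum-small i)
  where
  bound : ∀ {b r} → RowSum b r → ∣ r ∣≤ 1ℤ
  bound even-zero = -≤+ , +≤+ ℕ.z≤n
  bound even-neg  = ℤₚ.≤-refl , -≤+
  bound odd-zero  = -≤+ , +≤+ ℕ.z≤n
  bound odd-one   = -≤+ , ℤₚ.≤-refl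

entry-diagonal : ∀ {n} (i : Fin n) → entry i i ≡ 0ℤ
entry-diagonal zero    = refl
entry-diagonal (suc i) = entry-diagonal i

entry-sign : ∀ {n} (i j : Fin n) → i ≢ j → entry i j ≡ sign (alternating i j)
entry-sign zero    zero    i≢j = contradiction refl i≢j
entry-sign zero    (suc j) _   = sym (sign-not (even j))
entry-sign (suc i) zero    _   = refl
entry-sign (suc i) (suc j) i≢j = entry-sign i j (i≢j ∘ cong suc)

module SmallRows (n : ℕ) where
  open Sums n
  open Operators n
  open FromTournament (alternatingTournament n)

  s-entry : ∀ x y → s x y ≡ entry x y
  s-entry x y with x Fin.≟ y
  ... | yes refl = sym (entry-diagonal x)
  ... | no x≢y   = sym (entry-sign x y x≢y)

  h₁-abs : ∀ x → ∣ h 1 x ∣≤ 1ℤ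
  h₁-abs x = subst (∣_∣≤ 1ℤ) (sym (∑-cong λ y → ℤₚ.*-identityʳ (s x y) ⨾ s-entry x y)) (rowSum-abs x)

  ∑-abs : ∀ {f c} → (∀ x → ∣ f x ∣≤ c) → ∣ ∑ f ∣≤ N * c
  ∑-abs {f} {c} b =
    subst (_≤ ∑ f) (∑-const (- c) ⨾ sym (ℤₚ.neg-distribʳ-* N c)) (∑-mono λ x → proj₁ (b x)) ,
    subst (∑ f ≤_) (∑-const c) (∑-mono λ x → proj₂ (b x))

  apply-abs : ∀ {f c} → (∀ x → ∣ f x ∣≤ c) → ∀ x → ∣ apply s f x ∣≤ N * c
  apply-abs {f} {c} b x = ∑-abs {λ y → s x y * f y} λ y → subst (∣ s x y * f y ∣≤_) (ℤₚ.*-identityˡ c) (abs≤-* (s-abs x y) (b y))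

  norm-≤ : ∀ {f c} → (∀ x → ∣ f x ∣≤ c) → norm f ≤ N * (c * c)
  norm-≤ {f} {c} b = proj₂ (∑-abs {λ x → f x * f x} {c * c} λ x → abs≤-* (b x) (b x))

  p-≤ : p ≤ N * (1ℤ * 1ℤ)
  p-≤ = norm-≤ h₁-abs

  q-≤ : q ≤ N * (N * 1ℤ * (N * 1ℤ))
  q-≤ = norm-≤ {h 2} {N * 1ℤ} (apply-abs {h 1} h₁-abs)

  r-≤ : r ≤ N * (N * (N * 1ℤ) * (N * (N * 1ℤ)))
  r-≤ = norm-≤ {h 3} {N * (N * 1ℤ)} (apply-abs {h 2} {N * 1ℤ} (apply-abs {h 1} h₁-abs))

  N^-mono : ∀ a d → N ^ suc a ≤ N ^ suc (d ℕ.+ a)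
  N^-mono a zero    = ℤₚ.≤-refl
  N^-mono a (suc d) = ℤₚ.≤-trans (N^-mono a d) (step n (d ℕ.+ a))
    where
    step : ∀ m k → (+ m) ^ suc k ≤ (+ m) ^ suc (suc k)
    step zero    k = ℤₚ.≤-refl
    step (suc m) k = ℤₚ.≤-trans (ℤₚ.≤-reflexive (sym (ℤₚ.*-identityˡ _)))
      (ℤₚ.*-monoʳ-≤-nonNeg ((+ suc m) ^ suc k) {{nonNegative (pos-^-nonneg (suc m) (suc k))}} (+≤+ (ℕ.s≤s (ℕ.z≤n {m}))))

  -- The loss is at most 4n²; the cube puts it into the form `e * N ^ j` common to both lengths.
  trace-w₄-≥ : trace s 3 + N ^ 4 ≤ trace w 3 + + 4 * N ^ 3
  trace-w₄-≥ = begin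
    trace s 3 + N ^ 4
      ≡⟨ split (trace s 3) N p ⟩
    trace s 3 + (N ^ 4 - + 4 * N * p) + + 4 * N * p
      ≤⟨ ℤₚ.+-mono-≤ (ℤₚ.≤-reflexive (sym trace-w₄)) (ℤₚ.*-monoˡ-≤-nonNeg (+ 4 * N) {{nonNegative (0≤-* {+ 4} (+≤+ ℕ.z≤n) N-nonneg)}} p-≤) ⟩
    trace w 3 + + 4 * N * (N * (1ℤ * 1ℤ))
      ≡⟨ tidy (trace w 3) N ⟩
    trace w 3 + + 4 * N ^ 2
      ≤⟨ ℤₚ.+-monoʳ-≤ (trace w 3) (ℤₚ.*-monoˡ-≤-nonNeg (+ 4) (N^-mono 1 1)) ⟩
    trace w 3 + + 4 * N ^ 3 ∎
    where
    open ℤₚ.≤-Reasoning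
    split : ∀ t n p → t + n ^ 4 ≡ t + (n ^ 4 - + 4 * n * p) + + 4 * n * p
    split = solve 3 (λ t n p → t :+ n :^ 4 := t :+ (n :^ 4 :- con (+ 4) :* n :* p) :+ con (+ 4) :* n :* p) refl
      where open +-*-Solver
    tidy : ∀ t n → t + + 4 * n * (n * (1ℤ * 1ℤ)) ≡ t + + 4 * n ^ 2
    tidy = solve 2 (λ t n → t :+ con (+ 4) :* n :* (n :* (con 1ℤ :* con 1ℤ)) := t :+ con (+ 4) :* n :^ 2) refl
      where open +-*-Solver

  -- Entries of Ku are at most 1 in absolute value, and each further K costs a factor n, so p ≤ n, q
  -- ≤ n³ and r ≤ n⁵. The positive terms are then at most 8n⁶ + 8n⁶ + 8n⁴, whence 24 = 16 + 8.
  deficit₈-≤ : deficit₈ ≤ + 24 * N ^ 7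
  deficit₈-≤ = begin
    deficit₈
      ≡⟨ regroup N p q r ⟩
    + 8 * N ^ 5 * p + + 8 * N * r + + 8 * (p * q) - (+ 8 * N ^ 3 * q + + 12 * N ^ 2 * (p * p))
      ≤⟨ minus-≤ (ℤₚ.+-mono-≤ (0≤-* (0≤-* {+ 8} (+≤+ ℕ.z≤n) (pos-^-nonneg n 3)) (norm-nonneg (h 2)))
                              (0≤-* (0≤-* {+ 12} (+≤+ ℕ.z≤n) (pos-^-nonneg n 2)) (square-nonneg p))) ⟩
    + 8 * N ^ 5 * p + + 8 * N * r + + 8 * (p * q)
      ≤⟨ ℤₚ.+-mono-≤ (ℤₚ.+-mono-≤
           (ℤₚ.*-monoˡ-≤-nonNeg (+ 8 * N ^ 5) {{nonNegative (0≤-* {+ 8} (+≤+ ℕ.z≤n) (pos-^-nonneg n 5))}} p-≤)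
           (ℤₚ.*-monoˡ-≤-nonNeg (+ 8 * N) {{nonNegative (0≤-* {+ 8} (+≤+ ℕ.z≤n) N-nonneg)}} r-≤))
           (ℤₚ.*-monoˡ-≤-nonNeg (+ 8) (*-mono (norm-nonneg (h 1)) (ℤₚ.≤-trans (norm-nonneg (h 2)) q-≤) p-≤ q-≤)) ⟩
    + 8 * N ^ 5 * (N * (1ℤ * 1ℤ)) + + 8 * N * (N * (N * (N * 1ℤ) * (N * (N * 1ℤ)))) + + 8 * (N * (1ℤ * 1ℤ) * (N * (N * 1ℤ * (N * 1ℤ))))
      ≡⟨ tidy N ⟩
    + 16 * N ^ 6 + + 8 * N ^ 4
      ≤⟨ ℤₚ.+-mono-≤ (ℤₚ.*-monoˡ-≤-nonNeg (+ 16) (N^-mono 5 1)) (ℤₚ.*-monoˡ-≤-nonNeg (+ 8) (N^-mono 3 3)) ⟩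
    + 16 * N ^ 7 + + 8 * N ^ 7
      ≡⟨ ℤₚ.*-distribʳ-+ (N ^ 7) (+ 16) (+ 8) ⟨
    + 24 * N ^ 7 ∎
    where
    open ℤₚ.≤-Reasoning
    regroup : ∀ n p q r → + 8 * n ^ 5 * p - + 8 * n ^ 3 * q - + 12 * n ^ 2 * p * p + + 8 * n * r + + 8 * p * q
      ≡ + 8 * n ^ 5 * p + + 8 * n * r + + 8 * (p * q) - (+ 8 * n ^ 3 * q + + 12 * n ^ 2 * (p * p))
    regroup = solve 4 (λ n p q r →
      con (+ 8) :* n :^ 5 :* p :- con (+ 8) :* n :^ 3 :* q :- con (+ 12) :* n :^ 2 :* p :* p :+ con (+ 8) :* n :* r :+ con (+ 8) :* p :* q
      := con (+ 8) :* n :^ 5 :* p :+ con (+ 8) :* n :* r :+ con (+ 8) :* (p :* q)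
         :- (con (+ 8) :* n :^ 3 :* q :+ con (+ 12) :* n :^ 2 :* (p :* p))) refl
      where open +-*-Solver
    tidy : ∀ n → + 8 * n ^ 5 * (n * (1ℤ * 1ℤ)) + + 8 * n * (n * (n * (n * 1ℤ) * (n * (n * 1ℤ)))) + + 8 * (n * (1ℤ * 1ℤ) * (n * (n * 1ℤ * (n * 1ℤ))))
      ≡ + 16 * n ^ 6 + + 8 * n ^ 4
    tidy = solve 1 (λ n → con (+ 8) :* n :^ 5 :* (n :* (con 1ℤ :* con 1ℤ))
      :+ con (+ 8) :* n :* (n :* (n :* (n :* con 1ℤ) :* (n :* (n :* con 1ℤ))))
      :+ con (+ 8) :* (n :* (con 1ℤ :* con 1ℤ) :* (n :* (n :* con 1ℤ :* (n :* con 1ℤ))))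
      := con (+ 16) :* n :^ 6 :+ con (+ 8) :* n :^ 4) refl
      where open +-*-Solver

  trace-w₈-≥ : trace s 7 + N ^ 8 ≤ trace w 7 + + 24 * N ^ 7
  trace-w₈-≥ = begin
    trace s 7 + N ^ 8
      ≡⟨ split (trace s 7) (N ^ 8) deficit₈ ⟩
    trace s 7 + (N ^ 8 - deficit₈) + deficit₈
      ≤⟨ ℤₚ.+-mono-≤ (ℤₚ.≤-reflexive (sym trace-w₈)) deficit₈-≤ ⟩
    trace w 7 + + 24 * N ^ 7 ∎
    where
    open ℤₚ.≤-Reasoning
    split : ∀ t a d → t + a ≡ t + (a - d) + d
    split = solve-∀

-- Falling factorials

falling : ℕ → ℕ → ℕ
falling n k = k ! ℕ.* (n C k)

nCk*k![n-k]! : ∀ {n k} → k ℕ.≤ n → falling n k ℕ.* (n ℕ.∸ k) ! ≡ n !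
nCk*k![n-k]! {n} {k} k≤n = begin
  k ! ℕ.* (n C k) ℕ.* (n ℕ.∸ k) !
    ≡⟨ regroup (k !) (n C k) ((n ℕ.∸ k) !) ⟩
  (n C k) ℕ.* (k ! ℕ.* (n ℕ.∸ k) !)
    ≡⟨ cong (ℕ._* (k ! ℕ.* (n ℕ.∸ k) !)) (nCk≡n!/k![n-k]! k≤n) ⟩
  ((n !) DivMod./ (k ! ℕ.* (n ℕ.∸ k) !)) {{k ℕₚ.!* (n ℕ.∸ k) !≢0}} ℕ.* (k ! ℕ.* (n ℕ.∸ k) !)
    ≡⟨ DivMod.m/n*n≡m {{k ℕₚ.!* (n ℕ.∸ k) !≢0}} (subst (Divisibility._∣ n !) (ℕₚ.*-comm ((n ℕ.∸ k) !) (k !)) ([n∸k]!k!∣n! k≤n)) ⟩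
  n ! ∎
  where
  open ≡-Reasoning
  regroup : ∀ a b c → a ℕ.* b ℕ.* c ≡ b ℕ.* (a ℕ.* c)
  regroup = ℕ-Ring.solve-∀

falling-suc : ∀ n k → falling n (suc k) ≡ falling n k ℕ.* (n ℕ.∸ k)
falling-suc n k with k ℕₚ.<? n
... | no k≮n = cong (suc k ! ℕ.*_) (k>n⇒nCk≡0 {n} {suc k} (s≤s (ℕₚ.≮⇒≥ k≮n))) ⨾ ℕₚ.*-zeroʳ (suc k !)
  ⨾ sym (ℕₚ.*-zeroʳ (falling n k)) ⨾ cong (falling n k ℕ.*_) (sym (ℕₚ.m≤n⇒m∸n≡0 (ℕₚ.≮⇒≥ k≮n)))
... | yes k<n = ℕₚ.*-cancelʳ-≡ _ _ ((n ℕ.∸ suc k) !) {{(n ℕ.∸ suc k) ℕₚ.!≢0}} (begin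
  falling n (suc k) ℕ.* (n ℕ.∸ suc k) !
    ≡⟨ nCk*k![n-k]! k<n ⟩
  n !
    ≡⟨ nCk*k![n-k]! (ℕₚ.<⇒≤ k<n) ⟨
  falling n k ℕ.* (n ℕ.∸ k) !
    ≡⟨ cong (falling n k ℕ.*_) (cong _! e ⨾ cong (ℕ._* (n ℕ.∸ suc k) !) (sym e)) ⟩
  falling n k ℕ.* ((n ℕ.∸ k) ℕ.* (n ℕ.∸ suc k) !)
    ≡⟨ ℕₚ.*-assoc (falling n k) _ _ ⟨
  falling n k ℕ.* (n ℕ.∸ k) ℕ.* (n ℕ.∸ suc k) ! ∎)
  where
  open ≡-Reasoning
  e : n ℕ.∸ k ≡ suc (n ℕ.∸ suc k)
  e = ℕₚ.+-∸-assoc 1 k<n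

falling-≤ : ∀ n k → falling n k ℕ.≤ n ℕ.^ k
falling-≤ n zero    = ℕₚ.≤-refl
falling-≤ n (suc k) = begin
  falling n (suc k)           ≡⟨ falling-suc n k ⟩
  falling n k ℕ.* (n ℕ.∸ k)   ≤⟨ ℕₚ.*-mono-≤ (falling-≤ n k) (ℕₚ.m∸n≤m n k) ⟩
  n ℕ.^ k ℕ.* n               ≡⟨ ℕₚ.*-comm (n ℕ.^ k) n ⟩
  n ℕ.^ suc k ∎
  where open ℕₚ.≤-Reasoning

-- In the step, n is at most (k + 1) plus the next factor n ∸ (k + 1); the first summand adds k + 1
-- to the constant, which is the recursion of `triangular`.
falling-≥ : ∀ n k → n ℕ.^ suc k ℕ.≤ falling n (suc k) ℕ.+ triangular (suc k) ℕ.* n ℕ.^ k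
falling-≥ n zero    = ℕₚ.≤-reflexive (one n ⨾ cong (ℕ._+ 0) (sym (falling-suc n 0)))
  where
  one : ∀ n → n ℕ.* 1 ≡ 1 ℕ.* n ℕ.+ 0
  one = ℕ-Ring.solve-∀
falling-≥ n (suc k) = begin
  n ℕ.* n ℕ.^ suc k
    ≤⟨ ℕₚ.*-monoʳ-≤ n (falling-≥ n k) ⟩
  n ℕ.* (P ℕ.+ t ℕ.* n ℕ.^ k)
    ≡⟨ split n P t (n ℕ.^ k) ⟩
  P ℕ.* n ℕ.+ t ℕ.* (n ℕ.* n ℕ.^ k)
    ≤⟨ ℕₚ.+-monoˡ-≤ _ (ℕₚ.*-monoʳ-≤ P (ℕₚ.m≤n+m∸n n (suc k))) ⟩
  P ℕ.* (suc k ℕ.+ (n ℕ.∸ suc k)) ℕ.+ t ℕ.* n ℕ.^ suc k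
    ≡⟨ expand P (suc k) (n ℕ.∸ suc k) (t ℕ.* n ℕ.^ suc k) ⟩
  P ℕ.* (n ℕ.∸ suc k) ℕ.+ (suc k ℕ.* P ℕ.+ t ℕ.* n ℕ.^ suc k)
    ≤⟨ ℕₚ.+-mono-≤ (ℕₚ.≤-reflexive (sym (falling-suc n (suc k)))) (ℕₚ.+-monoˡ-≤ _ (ℕₚ.*-monoʳ-≤ (suc k) (falling-≤ n (suc k)))) ⟩
  falling n (suc (suc k)) ℕ.+ (suc k ℕ.* n ℕ.^ suc k ℕ.+ t ℕ.* n ℕ.^ suc k)
    ≡⟨ cong (falling n (suc (suc k)) ℕ.+_) (ℕₚ.*-distribʳ-+ (n ℕ.^ suc k) (suc k) t) ⟨
  falling n (suc (suc k)) ℕ.+ (suc k ℕ.+ t) ℕ.* n ℕ.^ suc k ∎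
  where
  open ℕₚ.≤-Reasoning
  P = falling n (suc k)
  t = triangular (suc k)
  split : ∀ n p t q → n ℕ.* (p ℕ.+ t ℕ.* q) ≡ p ℕ.* n ℕ.+ t ℕ.* (n ℕ.* q)
  split = ℕ-Ring.solve-∀
  expand : ∀ p k m r → p ℕ.* (k ℕ.+ m) ℕ.+ r ≡ p ℕ.* m ℕ.+ (k ℕ.* p ℕ.+ r)
  expand = ℕ-Ring.solve-∀

-- Clearing denominators

-- A positive ε has numerator at least 1, so 1 / d may replace it. The two hypotheses are the
-- one-sided estimates for 1 / d, multiplied by d · F · M.
∣∣<-rational : ∀ C K M F a .{{_ : NonZero M}} .{{_ : NonZero F}} (ε : ℚ) → 0ℚ ℚ.< ε → let d = ℚ.↧ₙ ε in
  d ℕ.* (F ℕ.* M ℕ.* C) ℕ.< d ℕ.* (a ℕ.* K) ℕ.+ F ℕ.* K →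
  d ℕ.* (a ℕ.* K) ℕ.< d ℕ.* (F ℕ.* M ℕ.* C) ℕ.+ F ℕ.* K →
  ℚ.∣ (+ C) ℚ./ 1 ℚ.- (+ a) ℚ./ F ℚ.* ((+ K) ℚ./ M) ∣ ℚ.< ε ℚ.* ((+ K) ℚ./ M)
∣∣<-rational C K M@(suc M-1) F@(suc F-1) a ε@(mkℚ (+ 0) d-1 _) (ℚ.*<* (ℤ.+<+ ())) _ _
∣∣<-rational C K M@(suc M-1) F@(suc F-1) a ε@(mkℚ -[1+ _ ] d-1 _) (ℚ.*<* ()) _ _
∣∣<-rational C K M@(suc M-1) F@(suc F-1) a ε@(mkℚ (+ (suc e)) d-1 _) _ upper lower = abs
  where
  d = suc d-1
  z : ℚ
  z = (+ K) ℚ./ M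
  p : ℚ
  p = (+ C) ℚ./ 1 ℚ.- (+ a) ℚ./ F ℚ.* z
  xᵘ yᵘ zᵘ : ℚᵘ
  xᵘ = mkℚᵘ (+ C) 0
  yᵘ = mkℚᵘ (+ a) F-1
  zᵘ = mkℚᵘ (+ K) M-1
  pᵘ : toℚᵘ p ℚᵘ.≃ xᵘ ℚᵘ.- yᵘ ℚᵘ.* zᵘ
  pᵘ = ℚᵘₚ.≃-trans (ℚₚ.toℚᵘ-homo-+ ((+ C) ℚ./ 1) (ℚ.- ((+ a) ℚ./ F ℚ.* z)))
    (ℚᵘₚ.+-cong (ℚₚ.toℚᵘ-fromℚᵘ xᵘ) (ℚᵘₚ.≃-trans (ℚₚ.toℚᵘ-homo‿- ((+ a) ℚ./ F ℚ.* z))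
      (ℚᵘₚ.-‿cong (ℚᵘₚ.≃-trans (ℚₚ.toℚᵘ-homo-* ((+ a) ℚ./ F) z) (ℚᵘₚ.*-cong (ℚₚ.toℚᵘ-fromℚᵘ yᵘ) (ℚₚ.toℚᵘ-fromℚᵘ zᵘ))))))
  qᵘ : toℚᵘ (ε ℚ.* z) ℚᵘ.≃ toℚᵘ ε ℚᵘ.* zᵘ
  qᵘ = ℚᵘₚ.≃-trans (ℚₚ.toℚᵘ-homo-* ε z) (ℚᵘₚ.*-cong ℚᵘₚ.≃-refl (ℚₚ.toℚᵘ-fromℚᵘ zᵘ))
  scale : ∀ u v → d ℕ.* u ℕ.< d ℕ.* v ℕ.+ F ℕ.* K →
    + (M ℕ.* (d ℕ.* u)) ℤ.- + (M ℕ.* (d ℕ.* v)) ℤ.< + (M ℕ.* (suc e ℕ.* (F ℕ.* K)))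
  scale u v h = subst (+ (M ℕ.* (d ℕ.* u)) ℤ.- + (M ℕ.* (d ℕ.* v)) ℤ.<_)
    (cancel (+ (M ℕ.* (d ℕ.* v))) (+ (M ℕ.* (suc e ℕ.* (F ℕ.* K)))))
    (ℤₚ.+-monoˡ-< (ℤ.- + (M ℕ.* (d ℕ.* v))) (ℤ.+<+ (ℕₚ.<-≤-trans (ℕₚ.*-monoʳ-< M h)
      (ℕₚ.≤-trans (ℕₚ.*-monoʳ-≤ M (ℕₚ.+-monoʳ-≤ (d ℕ.* v) (ℕₚ.m≤m+n (F ℕ.* K) (e ℕ.* (F ℕ.* K)))))
        (ℕₚ.≤-reflexive (ℕₚ.*-distribˡ-+ M (d ℕ.* v) _))))))
    where
    cancel : ∀ j k → j ℤ.+ k ℤ.- j ≡ k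
    cancel = solve-∀
  posW : + (M ℕ.* (d ℕ.* (F ℕ.* M ℕ.* C))) ≡ + M ℤ.* (+ d ℤ.* (+ F ℤ.* + M ℤ.* + C))
  posW = ℤₚ.pos-* M _ ⨾ cong (+ M ℤ.*_) (ℤₚ.pos-* d _ ⨾ cong (+ d ℤ.*_) (ℤₚ.pos-* (F ℕ.* M) C ⨾ cong (ℤ._* + C) (ℤₚ.pos-* F M)))
  posA : + (M ℕ.* (d ℕ.* (a ℕ.* K))) ≡ + M ℤ.* (+ d ℤ.* (+ a ℤ.* + K))
  posA = ℤₚ.pos-* M _ ⨾ cong (+ M ℤ.*_) (ℤₚ.pos-* d _ ⨾ cong (+ d ℤ.*_) (ℤₚ.pos-* a K))
  posE : + (M ℕ.* (suc e ℕ.* (F ℕ.* K))) ≡ + M ℤ.* (+ suc e ℤ.* (+ F ℤ.* + K))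
  posE = ℤₚ.pos-* M _ ⨾ cong (+ M ℤ.*_) (ℤₚ.pos-* (suc e) _ ⨾ cong (+ suc e ℤ.*_) (ℤₚ.pos-* F K))
  right : ∀ m e f k → m ℤ.* (e ℤ.* (f ℤ.* k)) ≡ (e ℤ.* k) ℤ.* (1ℤ ℤ.* (f ℤ.* m))
  right = solve-∀
  left₁ : ∀ m d f c a k → m ℤ.* (d ℤ.* (f ℤ.* m ℤ.* c)) ℤ.- m ℤ.* (d ℤ.* (a ℤ.* k))
    ≡ (c ℤ.* (f ℤ.* m) ℤ.+ (ℤ.- (a ℤ.* k)) ℤ.* 1ℤ) ℤ.* (d ℤ.* m)
  left₁ = solve-∀
  left₂ : ∀ m d f c a k → m ℤ.* (d ℤ.* (a ℤ.* k)) ℤ.- m ℤ.* (d ℤ.* (f ℤ.* m ℤ.* c))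
    ≡ (ℤ.- (c ℤ.* (f ℤ.* m) ℤ.+ (ℤ.- (a ℤ.* k)) ℤ.* 1ℤ)) ℤ.* (d ℤ.* m)
  left₂ = solve-∀
  p<q : p ℚ.< ε ℚ.* z
  p<q = ℚₚ.toℚᵘ-cancel-< (ℚᵘₚ.<-respˡ-≃ (ℚᵘₚ.≃-sym pᵘ) (ℚᵘₚ.<-respʳ-≃ (ℚᵘₚ.≃-sym qᵘ) (ℚᵘ.*<*
    (subst₂ ℤ._<_ (cong₂ ℤ._-_ posW posA ⨾ left₁ (+ M) (+ d) (+ F) (+ C) (+ a) (+ K)) (posE ⨾ right (+ M) (+ suc e) (+ F) (+ K))
      (scale (F ℕ.* M ℕ.* C) (a ℕ.* K) upper)))))
  -p<q : ℚ.- p ℚ.< ε ℚ.* z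
  -p<q = ℚₚ.toℚᵘ-cancel-< (ℚᵘₚ.<-respˡ-≃ (ℚᵘₚ.≃-sym (ℚᵘₚ.≃-trans (ℚₚ.toℚᵘ-homo‿- p) (ℚᵘₚ.-‿cong pᵘ)))
    (ℚᵘₚ.<-respʳ-≃ (ℚᵘₚ.≃-sym qᵘ) (ℚᵘ.*<*
    (subst₂ ℤ._<_ (cong₂ ℤ._-_ posA posW ⨾ left₂ (+ M) (+ d) (+ F) (+ C) (+ a) (+ K)) (posE ⨾ right (+ M) (+ suc e) (+ F) (+ K))
      (scale (a ℕ.* K) (F ℕ.* M ℕ.* C) lower)))))
  abs : ℚ.∣ p ∣ ℚ.< ε ℚ.* z
  abs with ℚₚ.∣p∣≡p∨∣p∣≡-p p
  ... | inj₁ eq = subst (ℚ._< ε ℚ.* z) (sym eq) p<q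
  ... | inj₂ eq = subst (ℚ._< ε ℚ.* z) (sym eq) -p<q

limit : ∀ j F a D .{{_ : NonZero F}} → let ℓ = suc j in
  (∀ n (T : Tournament n) → F ℕ.* 2 ℕ.^ ℓ ℕ.* cycleSeqs T ℓ ℕ.≤ a ℕ.* n ℕ.^ ℓ ℕ.+ D ℕ.* n ℕ.^ j) →
  (∀ n → ∃ λ (T : Tournament n) → a ℕ.* n ℕ.^ ℓ ℕ.≤ F ℕ.* 2 ℕ.^ ℓ ℕ.* cycleSeqs T ℓ ℕ.+ D ℕ.* n ℕ.^ j) →
  LimitIs ℓ ((+ a) ℚ./ F)
limit j F a D upper lower maxCycles isMax ε 0<ε = suc (ℓ ℕ.+ (b ℕ.+ d ℕ.* E)) , bound
  where
  ℓ = suc j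
  M = 2 ℕ.^ ℓ
  b = triangular ℓ
  d = ℚ.↧ₙ ε
  -- Three losses of order nʲ: replacing nˡ by the falling factorial, the given error, and the
  -- remainder in the division by `ℓ` that defines `numCycles`.
  E = a ℕ.* b ℕ.+ D ℕ.+ F ℕ.* M ℕ.* ℓ
  module _ (n : ℕ) (large : suc (ℓ ℕ.+ (b ℕ.+ d ℕ.* E)) ℕ.≤ n) where
    open ℕₚ.≤-Reasoning
    c K P q : ℕ
    c = maxCycles n
    K = j ! ℕ.* (n C ℓ)
    P = falling n ℓ
    q = n ℕ.^ j
    instance
      n≢0 : NonZero n
      n≢0 = ℕ.>-nonZero (ℕₚ.≤-trans (s≤s z≤n) large)
      M≢0 : NonZero M
      M≢0 = ℕₚ.m^n≢0 2 ℓ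
    1≤q : 1 ℕ.≤ q
    1≤q = ℕₚ.m^n>0 n j

    extremal : IsMaxCycles n ℓ c
    extremal = isMax n (ℕₚ.≤-trans (ℕₚ.≤-trans (ℕₚ.m≤m+n ℓ _) (ℕₚ.n≤1+n _)) large)

    W-≤ : F ℕ.* M ℕ.* (c ℕ.* ℓ) ℕ.≤ a ℕ.* n ℕ.^ ℓ ℕ.+ D ℕ.* q
    W-≤ with proj₁ extremal
    ... | T , refl′ = ℕₚ.≤-trans (ℕₚ.*-monoʳ-≤ (F ℕ.* M)
      (subst (λ m → m ℕ.* ℓ ℕ.≤ cycleSeqs T ℓ) refl′ (DivMod.m/n*n≤m (cycleSeqs T ℓ) ℓ))) (upper n T)

    W-≥ : a ℕ.* n ℕ.^ ℓ ℕ.≤ F ℕ.* M ℕ.* (ℓ ℕ.+ c ℕ.* ℓ) ℕ.+ D ℕ.* q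
    W-≥ with lower n
    ... | T , low = ℕₚ.≤-trans low (ℕₚ.+-monoˡ-≤ (D ℕ.* q) (ℕₚ.*-monoʳ-≤ (F ℕ.* M) (begin
      cycleSeqs T ℓ
        ≡⟨ DivMod.m≡m%n+[m/n]*n (cycleSeqs T ℓ) ℓ ⟩
      cycleSeqs T ℓ DivMod.% ℓ ℕ.+ numCycles T ℓ ℕ.* ℓ
        ≤⟨ ℕₚ.+-mono-≤ (ℕₚ.<⇒≤ (DivMod.m%n<n (cycleSeqs T ℓ) ℓ)) (ℕₚ.*-monoˡ-≤ ℓ (proj₂ extremal T)) ⟩
      ℓ ℕ.+ c ℕ.* ℓ ∎)))

    -- The threshold on n serves this: n > b + d · E gives (b + d · E) · nʲ < nˡ, while nˡ exceeds
    -- the falling factorial by at most b · nʲ.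
    small : d ℕ.* (E ℕ.* q) ℕ.< F ℕ.* P
    small = ℕₚ.<-≤-trans (ℕₚ.+-cancelˡ-< (b ℕ.* q) _ _ (begin-strict
      b ℕ.* q ℕ.+ d ℕ.* (E ℕ.* q)
        ≡⟨ cong (b ℕ.* q ℕ.+_) (sym (ℕₚ.*-assoc d E q)) ⨾ sym (ℕₚ.*-distribʳ-+ q b (d ℕ.* E)) ⟩
      (b ℕ.+ d ℕ.* E) ℕ.* q
        <⟨ ℕₚ.*-monoˡ-< q {{ℕ.>-nonZero 1≤q}} (ℕₚ.≤-trans (s≤s (ℕₚ.m≤n+m _ ℓ)) large) ⟩
      n ℕ.* q
        ≤⟨ falling-≥ n j ⟩
      P ℕ.+ b ℕ.* q
        ≡⟨ ℕₚ.+-comm P _ ⟩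
      b ℕ.* q ℕ.+ P ∎)) (ℕₚ.m≤n*m P F)

    cleared-< : d ℕ.* (F ℕ.* M ℕ.* c) ℕ.< d ℕ.* (a ℕ.* K) ℕ.+ F ℕ.* K
    cleared-< = ℕₚ.*-cancelʳ-< ℓ _ _ (begin-strict
      d ℕ.* (F ℕ.* M ℕ.* c) ℕ.* ℓ
        ≡⟨ assoc d (F ℕ.* M) c ℓ ⟩
      d ℕ.* (F ℕ.* M ℕ.* (c ℕ.* ℓ))
        ≤⟨ ℕₚ.*-monoʳ-≤ d (ℕₚ.≤-trans W-≤ (ℕₚ.+-monoˡ-≤ (D ℕ.* q) (ℕₚ.*-monoʳ-≤ a (falling-≥ n j)))) ⟩
      d ℕ.* (a ℕ.* (P ℕ.+ b ℕ.* q) ℕ.+ D ℕ.* q)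
        ≤⟨ ℕₚ.*-monoʳ-≤ d (ℕₚ.m≤m+n _ (F ℕ.* M ℕ.* ℓ ℕ.* q)) ⟩
      d ℕ.* (a ℕ.* (P ℕ.+ b ℕ.* q) ℕ.+ D ℕ.* q ℕ.+ F ℕ.* M ℕ.* ℓ ℕ.* q)
        ≡⟨ collect d a P b q D (F ℕ.* M ℕ.* ℓ) ⟩
      d ℕ.* (a ℕ.* P) ℕ.+ d ℕ.* (E ℕ.* q)
        <⟨ ℕₚ.+-monoʳ-< (d ℕ.* (a ℕ.* P)) small ⟩
      d ℕ.* (a ℕ.* P) ℕ.+ F ℕ.* P
        ≡⟨ factor d a F ℓ (j !) (n C ℓ) ⟩
      (d ℕ.* (a ℕ.* K) ℕ.+ F ℕ.* K) ℕ.* ℓ ∎)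
      where
      assoc : ∀ d m c l → d ℕ.* (m ℕ.* c) ℕ.* l ≡ d ℕ.* (m ℕ.* (c ℕ.* l))
      assoc = ℕ-Ring.solve-∀
      collect : ∀ d a p b q D m → d ℕ.* (a ℕ.* (p ℕ.+ b ℕ.* q) ℕ.+ D ℕ.* q ℕ.+ m ℕ.* q)
        ≡ d ℕ.* (a ℕ.* p) ℕ.+ d ℕ.* ((a ℕ.* b ℕ.+ D ℕ.+ m) ℕ.* q)
      collect = ℕ-Ring.solve-∀
      factor : ∀ d a f l g h → d ℕ.* (a ℕ.* (l ℕ.* g ℕ.* h)) ℕ.+ f ℕ.* (l ℕ.* g ℕ.* h)
        ≡ (d ℕ.* (a ℕ.* (g ℕ.* h)) ℕ.+ f ℕ.* (g ℕ.* h)) ℕ.* l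
      factor = ℕ-Ring.solve-∀

    cleared-> : d ℕ.* (a ℕ.* K) ℕ.< d ℕ.* (F ℕ.* M ℕ.* c) ℕ.+ F ℕ.* K
    cleared-> = ℕₚ.*-cancelʳ-< ℓ _ _ (begin-strict
      d ℕ.* (a ℕ.* K) ℕ.* ℓ
        ≡⟨ toP d a ℓ (j !) (n C ℓ) ⟩
      d ℕ.* (a ℕ.* P)
        ≤⟨ ℕₚ.*-monoʳ-≤ d (ℕₚ.≤-trans (ℕₚ.*-monoʳ-≤ a (falling-≤ n ℓ)) W-≥) ⟩
      d ℕ.* (F ℕ.* M ℕ.* (ℓ ℕ.+ c ℕ.* ℓ) ℕ.+ D ℕ.* q)
        ≡⟨ expand d (F ℕ.* M) ℓ c (D ℕ.* q) ⟩
      d ℕ.* (F ℕ.* M ℕ.* c) ℕ.* ℓ ℕ.+ d ℕ.* (D ℕ.* q ℕ.+ F ℕ.* M ℕ.* ℓ ℕ.* 1)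
        ≤⟨ ℕₚ.+-monoʳ-≤ (d ℕ.* (F ℕ.* M ℕ.* c) ℕ.* ℓ) (ℕₚ.*-monoʳ-≤ d (ℕₚ.≤-trans
             (ℕₚ.+-monoʳ-≤ (D ℕ.* q) (ℕₚ.*-monoʳ-≤ (F ℕ.* M ℕ.* ℓ) 1≤q))
             (ℕₚ.m≤n+m _ (a ℕ.* b ℕ.* q)))) ⟩
      d ℕ.* (F ℕ.* M ℕ.* c) ℕ.* ℓ ℕ.+ d ℕ.* (a ℕ.* b ℕ.* q ℕ.+ (D ℕ.* q ℕ.+ F ℕ.* M ℕ.* ℓ ℕ.* q))
        ≡⟨ cong (λ e → d ℕ.* (F ℕ.* M ℕ.* c) ℕ.* ℓ ℕ.+ d ℕ.* e) (collect (a ℕ.* b) D (F ℕ.* M ℕ.* ℓ) q) ⟩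
      d ℕ.* (F ℕ.* M ℕ.* c) ℕ.* ℓ ℕ.+ d ℕ.* (E ℕ.* q)
        <⟨ ℕₚ.+-monoʳ-< (d ℕ.* (F ℕ.* M ℕ.* c) ℕ.* ℓ) small ⟩
      d ℕ.* (F ℕ.* M ℕ.* c) ℕ.* ℓ ℕ.+ F ℕ.* P
        ≡⟨ factor (d ℕ.* (F ℕ.* M ℕ.* c)) F ℓ (j !) (n C ℓ) ⟩
      (d ℕ.* (F ℕ.* M ℕ.* c) ℕ.+ F ℕ.* K) ℕ.* ℓ ∎)
      where
      toP : ∀ d a l g h → d ℕ.* (a ℕ.* (g ℕ.* h)) ℕ.* l ≡ d ℕ.* (a ℕ.* (l ℕ.* g ℕ.* h))
      toP = ℕ-Ring.solve-∀
      expand : ∀ d m l c e → d ℕ.* (m ℕ.* (l ℕ.+ c ℕ.* l) ℕ.+ e) ≡ d ℕ.* (m ℕ.* c) ℕ.* l ℕ.+ d ℕ.* (e ℕ.+ m ℕ.* l ℕ.* 1)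
      expand = ℕ-Ring.solve-∀
      collect : ∀ ab D m q → ab ℕ.* q ℕ.+ (D ℕ.* q ℕ.+ m ℕ.* q) ≡ (ab ℕ.+ D ℕ.+ m) ℕ.* q
      collect = ℕ-Ring.solve-∀
      factor : ∀ w f l g h → w ℕ.* l ℕ.+ f ℕ.* (l ℕ.* g ℕ.* h) ≡ (w ℕ.+ f ℕ.* (g ℕ.* h)) ℕ.* l
      factor = ℕ-Ring.solve-∀

    bound : ℚ.∣ (+ c) ℚ./ 1 ℚ.- (+ a) ℚ./ F ℚ.* R n ℓ ∣ ℚ.< ε ℚ.* R n ℓ
    bound = ∣∣<-rational c K M F a ε 0<ε cleared-< cleared->

-- Assembly of the two limits

pos-^ : ∀ n k → (+ n) ^ k ≡ + (n ℕ.^ k)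
pos-^ n zero    = refl
pos-^ n (suc k) = cong (+ n *_) (pos-^ n k) ⨾ sym (ℤₚ.pos-* n (n ℕ.^ k))

pos-*^ : ∀ a n k → + a * (+ n) ^ k ≡ + (a ℕ.* n ℕ.^ k)
pos-*^ a n k = cong (+ a *_) (pos-^ n k) ⨾ sym (ℤₚ.pos-* a (n ℕ.^ k))

pos-count : ∀ F ℓ z → + F * ((+ 2) ^ ℓ * + z) ≡ + (F ℕ.* 2 ℕ.^ ℓ ℕ.* z)
pos-count F ℓ z = sym (ℤₚ.*-assoc (+ F) ((+ 2) ^ ℓ) (+ z)) ⨾ cong (_* + z) (pos-*^ F 2 ℓ) ⨾ sym (ℤₚ.pos-* (F ℕ.* 2 ℕ.^ ℓ) z)

doublePaths-one₃ : ∀ {A : Set} (xs : List A) → length xs ≡ 3 → doublePaths (λ _ _ → 1ℤ) (λ _ → 1ℤ) 1 xs ≡ + 6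
doublePaths-one₃ (_ ∷ _ ∷ _ ∷ []) refl = refl

doublePaths-one₇ : ∀ {A : Set} (xs : List A) → length xs ≡ 7 → doublePaths (λ _ _ → 1ℤ) (λ _ → 1ℤ) 3 xs ≡ + 5040
doublePaths-one₇ (_ ∷ _ ∷ _ ∷ _ ∷ _ ∷ _ ∷ _ ∷ []) refl = refl

-- F = (2k + 1)! and b is the extremal value of doublePaths k; e bounds the loss through irregularity.
module Combine (k F b e : ℕ) .{{_ : ℕ.NonZero F}} (F≡ : orderings k ≡ + F)
  (total : ∀ {A : Set} (xs : List A) → length xs ≡ suc (k ℕ.+ k) → doublePaths (λ _ _ → 1ℤ) (λ _ → 1ℤ) k xs ≡ + F)
  (local-≤ : ∀ {A : Set} (t : A → A → Bool) xs → length xs ≡ suc (k ℕ.+ k) → AllPairs (Sorting.Skew t) xs → Extremal.D t k xs ≤ + b)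
  (local-≡ : ∀ {A : Set} (t : A → A → Bool) → Transitive (Sorting._⟶_ t) →
             ∀ xs → length xs ≡ suc (k ℕ.+ k) → AllPairs (Sorting.Skew t) xs → Extremal.D t k xs ≡ + b)
  where

  j ℓ π a D : ℕ
  j = suc (k ℕ.+ k)
  ℓ = suc j
  π = triangular ℓ
  a = F ℕ.+ b
  -- In order: tuples with repetitions in the sum of squares, closed walks with repetitions in the
  -- trace of J + K, and irregularity of the scores.
  D = a ℕ.* π ℕ.+ F ℕ.* (2 ℕ.^ ℓ ℕ.* π ℕ.+ e)

  module _ {n : ℕ} (T : Tournament n) where
    open FromTournament T
    open Local.Estimates T k (+ b) (+ F) (+≤+ ℕ.z≤n) (+≤+ ℕ.z≤n) total using (squares; error; squares-≤; squares-≥)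

    upper : trace s j ≡ squares → trace w j ≤ trace s j + N ^ ℓ →
      F ℕ.* 2 ℕ.^ ℓ ℕ.* cycleSeqs T ℓ ℕ.≤ a ℕ.* n ℕ.^ ℓ ℕ.+ D ℕ.* n ℕ.^ j
    upper trace-s trace-w = ℕₚ.≤-trans (drop‿+≤+ (begin
      + (F ℕ.* 2 ℕ.^ ℓ ℕ.* cycleSeqs T ℓ)
        ≡⟨ pos-count F ℓ (cycleSeqs T ℓ) ⟨
      + F * ((+ 2) ^ ℓ * + cycleSeqs T ℓ)
        ≤⟨ ℤₚ.*-monoˡ-≤-nonNeg (+ F) (ℤₚ.≤-trans (cycleSeqs-≤ j) trace-w) ⟩
      + F * (trace s j + N ^ ℓ)
        ≡⟨ ℤₚ.*-distribˡ-+ (+ F) (trace s j) (N ^ ℓ) ⨾ cong (_+ + F * N ^ ℓ) (cong₂ _*_ (sym F≡) trace-s) ⟩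
      orderings k * squares + + F * N ^ ℓ
        ≤⟨ ℤₚ.+-monoˡ-≤ (+ F * N ^ ℓ) (squares-≤ λ {t} → local-≤ t) ⟩
      N ^ ℓ * + b + error + + F * N ^ ℓ
        ≡⟨ collect (N ^ ℓ) (+ b) (+ F) (N ^ j) (+ π) ⟩
      + a * N ^ ℓ + (+ a * + π) * N ^ j
        ≡⟨ cong₂ _+_ (pos-*^ a n ℓ) (cong (_* N ^ j) (sym (ℤₚ.pos-* a π)) ⨾ pos-*^ (a ℕ.* π) n j) ⟩
      + (a ℕ.* n ℕ.^ ℓ ℕ.+ a ℕ.* π ℕ.* n ℕ.^ j) ∎))
      (ℕₚ.+-monoʳ-≤ (a ℕ.* n ℕ.^ ℓ) (ℕₚ.*-monoˡ-≤ (n ℕ.^ j) (ℕₚ.m≤m+n (a ℕ.* π) _)))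
      where
      open ℤₚ.≤-Reasoning
      collect : ∀ x b f y p → x * b + (f + b) * (p * y) + f * x ≡ (f + b) * x + ((f + b) * p) * y
      collect = solve-∀

    lower : trace s j ≡ squares → trace s j + N ^ ℓ ≤ trace w j + + e * N ^ j →
      (∀ v → Transitive (Sorting._⟶_ (Local.switched T v))) →
      a ℕ.* n ℕ.^ ℓ ℕ.≤ F ℕ.* 2 ℕ.^ ℓ ℕ.* cycleSeqs T ℓ ℕ.+ D ℕ.* n ℕ.^ j
    lower trace-s trace-w transitive = drop‿+≤+ (begin
      + (a ℕ.* n ℕ.^ ℓ)
        ≡⟨ sym (pos-*^ a n ℓ) ⨾ ℤₚ.*-distribʳ-+ (N ^ ℓ) (+ F) (+ b) ⨾ cong (λ x → + F * N ^ ℓ + x) (ℤₚ.*-comm (+ b) (N ^ ℓ)) ⟩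
      + F * N ^ ℓ + N ^ ℓ * + b
        ≤⟨ ℤₚ.+-monoʳ-≤ (+ F * N ^ ℓ) (squares-≥ λ v → local-≡ (Local.switched T v) (transitive v)) ⟩
      + F * N ^ ℓ + (orderings k * squares + error)
        ≡⟨ cong (λ x → + F * N ^ ℓ + (x + error)) (cong₂ _*_ F≡ (sym trace-s))
           ⨾ first (+ F) (N ^ ℓ) (trace s j) (+ a * (+ π * N ^ j)) ⟩
      + F * (trace s j + N ^ ℓ) + + a * (+ π * N ^ j)
        ≤⟨ ℤₚ.+-monoˡ-≤ (+ a * (+ π * N ^ j)) (ℤₚ.*-monoˡ-≤-nonNeg (+ F) (ℤₚ.≤-trans trace-w (ℤₚ.+-monoˡ-≤ (+ e * N ^ j) (trace-w-≤ (k ℕ.+ k))))) ⟩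
      + F * ((+ 2) ^ ℓ * + cycleSeqs T ℓ + (+ 2) ^ ℓ * (+ π * N ^ j) + + e * N ^ j) + + a * (+ π * N ^ j)
        ≡⟨ collect (+ F) ((+ 2) ^ ℓ) (+ cycleSeqs T ℓ) (+ π) (N ^ j) (+ e) (+ a) ⟩
      + F * ((+ 2) ^ ℓ * + cycleSeqs T ℓ) + (+ a * + π + + F * ((+ 2) ^ ℓ * + π + + e)) * N ^ j
        ≡⟨ cong₂ _+_ (pos-count F ℓ (cycleSeqs T ℓ)) (cong (_* N ^ j) constant ⨾ pos-*^ D n j) ⟩
      + (F ℕ.* 2 ℕ.^ ℓ ℕ.* cycleSeqs T ℓ ℕ.+ D ℕ.* n ℕ.^ j) ∎)
      where
      open ℤₚ.≤-Reasoning
      first : ∀ f x t y → f * x + (f * t + y) ≡ f * (t + x) + y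
      first = solve-∀
      collect : ∀ f m z p y e a → f * (m * z + m * (p * y) + e * y) + a * (p * y) ≡ f * (m * z) + (a * p + f * (m * p + e)) * y
      collect = solve-∀
      constant : + a * + π + + F * ((+ 2) ^ ℓ * + π + + e) ≡ + D
      constant = cong₂ _+_ (sym (ℤₚ.pos-* a π)) (cong (λ x → + F * (x * + π + + e)) (pos-^ 2 ℓ)
        ⨾ cong (λ x → + F * (x + + e)) (sym (ℤₚ.pos-* (2 ℕ.^ ℓ) π)) ⨾ sym (ℤₚ.pos-* F _))


module Four = Combine 1 6 2 4 refl doublePaths-one₃ Extremal.D₁-≤ Extremal.D₁-transitive
module Eight = Combine 3 5040 272 24 refl doublePaths-one₇ Extremal.D₃-≤ Extremal.D₃-transitive

theorem20 : LimitIs 4 ((+ 4) / 3) × LimitIs 8 ((+ 332) / 315)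
theorem20 =
  -- The quotients (F + b) / F are 8 / 6 and 5312 / 5040; they reduce to 4 / 3 and 332 / 315 by
  -- evaluation.
  limit 3 6 8 Four.D
    (λ n T → Four.upper T (FromTournament.trace-s₄ T) (FromTournament.trace-w₄-≤ T))
    (λ n → T n , Four.lower (T n) (FromTournament.trace-s₄ (T n)) (SmallRows.trace-w₄-≥ n) (Alternating.switched-transitive n)) ,
  limit 7 5040 5312 Eight.D
    (λ n T → Eight.upper T (FromTournament.trace-s₈ T) (FromTournament.trace-w₈-≤ T))
    (λ n → T n , Eight.lower (T n) (FromTournament.trace-s₈ (T n)) (SmallRows.trace-w₈-≥ n) (Alternating.switched-transitive n))
  where
  T = alternatingTournament
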